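{- The sets $\mathrm{SPP}(n)$ and $\mathrm{SPP}_{\mathbb{R}_+}(n)$ for $n\le 4$ have the following values: \begin{align*} \mathrm{SPP}_{\mathbb{R}_+}(1) &= \mathrm{SPP}(1) = \{(1,1)\},\\ \mathrm{SPP}_{\mathbb{R}_+}(2) &= \mathrm{SPP}(2) = \{(3,3)\},\\ \mathrm{SPP}_{\mathbb{R}_+}(3) &= \mathrm{SPP}(3) = \{(5,6),(6,5),(6,6)\},\\ \mathrm{SPP}(4) &= \{(i,j) : 7\le i\le 10,\ 9\le j\le 10\}\cup\{(10,7),(10,8)\},\\ \mathrm{SPP}_{\mathbb{R}_+}(4) &= \mathrm{SPP}(4)\cup\{(9,7),(9,8)\}, \end{align*} where $i,j$ denote integers.
   Context: For a finite set $A$ of real numbers, $A+A=\{x+y : x,y\in A\}$ and $AA=\{xy : x,y\in A\}$ (here $x=y$ is allowed). For a set $X$ of real numbers and a positive integer $n$, define the set of sum-product pairs $\mathrm{SPP}_X(n)=\{(|A+A|,|AA|) : A\subseteq X,\ |A|=n\}$. Write $\mathrm{SPP}(n)=\mathrm{SPP}_{\mathbb{N}}(n)$, where $\mathbb{N}$ is the set of positive integers, and let $\mathbb{R}_+$ be the set of positive real numbers. -}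

module Defs where

open import Data.Fin.Base using (Fin)
open import Data.Integer.Base as ℤ using ()
open import Data.Nat.Base as ℕ using (ℕ)
import Data.Nat.Properties as ℕ
open import Data.Product.Base using (Σ-syntax; ∃-syntax; _×_; _,_)
open import Data.Rational.Base as ℚ using (ℚ; 0ℚ; 1ℚ; ½; ∣_∣; 1/_)
import Data.Rational.Properties as ℚ
open import Data.Rational.Solver using (module +-*-Solver)
open import Function.Bundles using (_⇔_)
open import Function.Definitions using (Injective)
open import Level using (0ℓ; suc)
open import Relation.Binary.PropositionalEquality
  using (_≡_; refl; sym; trans; cong; cong₂; subst)
open import Relation.Unary using (Pred; _∈_; _⊆_)

-- The reals are the Cauchy completion of ℚ.  There are no quotient types, so
-- equality of reals is the relation _≈_ below, and every notion concerning
-- sets of reals is formulated up to _≈_.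

IsCauchy : (ℕ → ℚ) → Set
IsCauchy x = ∀ ε → 0ℚ ℚ.< ε →
  ∃[ N ] (∀ m n → N ℕ.≤ m → N ℕ.≤ n → ∣ x m ℚ.- x n ∣ ℚ.< ε)

record ℝ : Set where
  constructor mkℝ
  field
    seq    : ℕ → ℚ
    cauchy : IsCauchy seq

open ℝ public

infix 4 _≈_

_≈_ : ℝ → ℝ → Set
x ≈ y = ∀ ε → 0ℚ ℚ.< ε →
  ∃[ N ] (∀ n → N ℕ.≤ n → ∣ seq x n ℚ.- seq y n ∣ ℚ.< ε)

ℝ₊ : Pred ℝ 0ℓ
ℝ₊ x = ∃[ ε ] (0ℚ ℚ.< ε × ∃[ N ] (∀ n → N ℕ.≤ n → ε ℚ.< seq x n))

constant-isCauchy : ∀ q → IsCauchy (λ _ → q)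
constant-isCauchy q ε 0<ε =
  0 , λ _ _ _ _ → subst (λ d → ∣ d ∣ ℚ.< ε) (sym (ℚ.+-inverseʳ q)) 0<ε

fromℚ : ℚ → ℝ
fromℚ q = mkℝ (λ _ → q) (constant-isCauchy q)

fromℕ : ℕ → ℝ
fromℕ k = fromℚ (ℤ.+ k ℚ./ 1)

private
  half-pos : ∀ {ε} → 0ℚ ℚ.< ε → 0ℚ ℚ.< ½ ℚ.* ε
  half-pos {ε} 0<ε =
    ℚ.positive⁻¹ (½ ℚ.* ε) {{ℚ.pos*pos⇒pos ½ ε {{ℚ.positive 0<ε}}}}

  half+half : ∀ ε → ½ ℚ.* ε ℚ.+ ½ ℚ.* ε ≡ ε
  half+half ε = trans (sym (ℚ.*-distribʳ-+ ε ½ ½)) (ℚ.*-identityˡ ε)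

  sum-diff : ∀ a b c d → (a ℚ.+ b) ℚ.- (c ℚ.+ d) ≡ (a ℚ.- c) ℚ.+ (b ℚ.- d)
  sum-diff = solve 4 (λ a b c d →
    (a :+ b) :- (c :+ d) := (a :- c) :+ (b :- d)) refl
    where open +-*-Solver

  prod-diff : ∀ a b c d →
    a ℚ.* b ℚ.- c ℚ.* d ≡ a ℚ.* (b ℚ.- d) ℚ.+ (a ℚ.- c) ℚ.* d
  prod-diff = solve 4 (λ a b c d →
    a :* b :- c :* d := a :* (b :- d) :+ (a :- c) :* d) refl
    where open +-*-Solver

  split : ∀ a b → a ≡ b ℚ.+ (a ℚ.- b)
  split = solve 2 (λ a b → a := b :+ (a :- b)) refl
    where open +-*-Solver

  eventually-bounded : ∀ x → IsCauchy x →
    Σ[ B ∈ ℚ ] (0ℚ ℚ.< B × ∃[ N ] (∀ n → N ℕ.≤ n → ∣ x n ∣ ℚ.≤ B))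
  eventually-bounded x cx with cx 1ℚ (ℚ.positive⁻¹ 1ℚ)
  ... | N , close =
    ∣ x N ∣ ℚ.+ 1ℚ
    , ℚ.+-mono-≤-< (ℚ.0≤∣p∣ (x N)) (ℚ.positive⁻¹ 1ℚ)
    , N
    , λ n N≤n → let open ℚ.≤-Reasoning in begin
        ∣ x n ∣                        ≡⟨ cong ∣_∣ (split (x n) (x N)) ⟩
        ∣ x N ℚ.+ (x n ℚ.- x N) ∣      ≤⟨ ℚ.∣p+q∣≤∣p∣+∣q∣ (x N) (x n ℚ.- x N) ⟩
        ∣ x N ∣ ℚ.+ ∣ x n ℚ.- x N ∣    ≤⟨ ℚ.+-monoʳ-≤ ∣ x N ∣
                                            (ℚ.<⇒≤ (close n N N≤n ℕ.≤-refl)) ⟩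
        ∣ x N ∣ ℚ.+ 1ℚ                 ∎

  divide-pos : ∀ {B ε} → 0ℚ ℚ.< B → 0ℚ ℚ.< ε →
    Σ[ δ ∈ ℚ ] (0ℚ ℚ.< δ × B ℚ.* δ ≡ ε)
  divide-pos {B} {ε} 0<B 0<ε =
    1/B ℚ.* ε
    , ℚ.positive⁻¹ (1/B ℚ.* ε)
        {{ℚ.pos*pos⇒pos 1/B {{ℚ.1/pos⇒pos B}} ε {{ℚ.positive 0<ε}}}}
    , trans (sym (ℚ.*-assoc B 1/B ε))
        (trans (cong (ℚ._* ε) (ℚ.*-inverseʳ B)) (ℚ.*-identityˡ ε))
    where
    instance
      B-pos : ℚ.Positive B
      B-pos = ℚ.positive 0<B
      B-nonZero : ℚ.NonZero B
      B-nonZero = ℚ.pos⇒nonZero B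
    1/B : ℚ
    1/B = 1/ B

  mul-bound : ∀ {B δ} a b → 0ℚ ℚ.< B → ∣ a ∣ ℚ.≤ B → ∣ b ∣ ℚ.< δ →
    ∣ a ℚ.* b ∣ ℚ.< B ℚ.* δ
  mul-bound {B} {δ} a b 0<B a≤B b<δ = let open ℚ.≤-Reasoning in begin-strict
    ∣ a ℚ.* b ∣      ≡⟨ ℚ.∣p*q∣≡∣p∣*∣q∣ a b ⟩
    ∣ a ∣ ℚ.* ∣ b ∣  ≤⟨ ℚ.*-monoʳ-≤-nonNeg ∣ b ∣
                          {{ℚ.nonNegative (ℚ.0≤∣p∣ b)}} a≤B ⟩
    B ℚ.* ∣ b ∣      <⟨ ℚ.*-monoʳ-<-pos B {{ℚ.positive 0<B}} b<δ ⟩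
    B ℚ.* δ          ∎

+-isCauchy : ∀ x y → IsCauchy x → IsCauchy y → IsCauchy (λ n → x n ℚ.+ y n)
+-isCauchy x y cx cy ε 0<ε
  with cx (½ ℚ.* ε) (half-pos 0<ε) | cy (½ ℚ.* ε) (half-pos 0<ε)
... | M , cx′ | N , cy′ = M ℕ.⊔ N , λ m n h k →
  let open ℚ.≤-Reasoning in begin-strict
    ∣ (x m ℚ.+ y m) ℚ.- (x n ℚ.+ y n) ∣
      ≡⟨ cong ∣_∣ (sum-diff (x m) (y m) (x n) (y n)) ⟩
    ∣ (x m ℚ.- x n) ℚ.+ (y m ℚ.- y n) ∣
      ≤⟨ ℚ.∣p+q∣≤∣p∣+∣q∣ (x m ℚ.- x n) (y m ℚ.- y n) ⟩
    ∣ x m ℚ.- x n ∣ ℚ.+ ∣ y m ℚ.- y n ∣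
      <⟨ ℚ.+-mono-< (cx′ m n (ℕ.m⊔n≤o⇒m≤o M N h) (ℕ.m⊔n≤o⇒m≤o M N k))
                    (cy′ m n (ℕ.m⊔n≤o⇒n≤o M N h) (ℕ.m⊔n≤o⇒n≤o M N k)) ⟩
    ½ ℚ.* ε ℚ.+ ½ ℚ.* ε
      ≡⟨ half+half ε ⟩
    ε ∎

private
  *-close : ∀ (x y : ℕ → ℚ) {ε B C δ η} K L M N →
    0ℚ ℚ.< B → (∀ n → K ℕ.≤ n → ∣ x n ∣ ℚ.≤ B) →
    0ℚ ℚ.< C → (∀ n → L ℕ.≤ n → ∣ y n ∣ ℚ.≤ C) →
    B ℚ.* δ ≡ ½ ℚ.* ε → C ℚ.* η ≡ ½ ℚ.* ε →
    (∀ m n → M ℕ.≤ m → M ℕ.≤ n → ∣ y m ℚ.- y n ∣ ℚ.< δ) →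
    (∀ m n → N ℕ.≤ m → N ℕ.≤ n → ∣ x m ℚ.- x n ∣ ℚ.< η) →
    ∀ m n → (K ℕ.⊔ L) ℕ.⊔ (M ℕ.⊔ N) ℕ.≤ m → (K ℕ.⊔ L) ℕ.⊔ (M ℕ.⊔ N) ℕ.≤ n →
    ∣ x m ℚ.* y m ℚ.- x n ℚ.* y n ∣ ℚ.< ε
  *-close x y {ε} {B} {C} {δ} {η} K L M N 0<B x≤B 0<C y≤C Bδ Cη cy cx m n h k =
    begin-strict
    ∣ x m ℚ.* y m ℚ.- x n ℚ.* y n ∣
      ≡⟨ cong ∣_∣ (prod-diff (x m) (y m) (x n) (y n)) ⟩
    ∣ x m ℚ.* (y m ℚ.- y n) ℚ.+ (x m ℚ.- x n) ℚ.* y n ∣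
      ≤⟨ ℚ.∣p+q∣≤∣p∣+∣q∣ (x m ℚ.* (y m ℚ.- y n)) ((x m ℚ.- x n) ℚ.* y n) ⟩
    ∣ x m ℚ.* (y m ℚ.- y n) ∣ ℚ.+ ∣ (x m ℚ.- x n) ℚ.* y n ∣
      ≡⟨ cong (λ t → ∣ x m ℚ.* (y m ℚ.- y n) ∣ ℚ.+ ∣ t ∣)
           (ℚ.*-comm (x m ℚ.- x n) (y n)) ⟩
    ∣ x m ℚ.* (y m ℚ.- y n) ∣ ℚ.+ ∣ y n ℚ.* (x m ℚ.- x n) ∣
      <⟨ ℚ.+-mono-<
           (mul-bound (x m) (y m ℚ.- y n) 0<B (x≤B m (ℕ.m⊔n≤o⇒m≤o K L (KL h)))
             (cy m n (ℕ.m⊔n≤o⇒m≤o M N (MN h)) (ℕ.m⊔n≤o⇒m≤o M N (MN k))))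
           (mul-bound (y n) (x m ℚ.- x n) 0<C (y≤C n (ℕ.m⊔n≤o⇒n≤o K L (KL k)))
             (cx m n (ℕ.m⊔n≤o⇒n≤o M N (MN h)) (ℕ.m⊔n≤o⇒n≤o M N (MN k)))) ⟩
    B ℚ.* δ ℚ.+ C ℚ.* η
      ≡⟨ cong₂ ℚ._+_ Bδ Cη ⟩
    ½ ℚ.* ε ℚ.+ ½ ℚ.* ε
      ≡⟨ half+half ε ⟩
    ε ∎
    where
    open ℚ.≤-Reasoning
    KL : ∀ {o} → (K ℕ.⊔ L) ℕ.⊔ (M ℕ.⊔ N) ℕ.≤ o → K ℕ.⊔ L ℕ.≤ o
    KL = ℕ.m⊔n≤o⇒m≤o (K ℕ.⊔ L) (M ℕ.⊔ N)
    MN : ∀ {o} → (K ℕ.⊔ L) ℕ.⊔ (M ℕ.⊔ N) ℕ.≤ o → M ℕ.⊔ N ℕ.≤ o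
    MN = ℕ.m⊔n≤o⇒n≤o (K ℕ.⊔ L) (M ℕ.⊔ N)

*-isCauchy : ∀ x y → IsCauchy x → IsCauchy y → IsCauchy (λ n → x n ℚ.* y n)
*-isCauchy x y cx cy ε 0<ε =
  let B , 0<B , K , x≤B = eventually-bounded x cx
      C , 0<C , L , y≤C = eventually-bounded y cy
      δ , 0<δ , Bδ      = divide-pos 0<B (half-pos 0<ε)
      η , 0<η , Cη      = divide-pos 0<C (half-pos 0<ε)
      M , cy′           = cy δ 0<δ
      N , cx′           = cx η 0<η
  in (K ℕ.⊔ L) ℕ.⊔ (M ℕ.⊔ N)
     , *-close x y K L M N 0<B x≤B 0<C y≤C Bδ Cη cy′ cx′

infixl 6 _+_
infixl 7 _*_

_+_ : ℝ → ℝ → ℝ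
x + y = mkℝ (λ n → seq x n ℚ.+ seq y n)
  (+-isCauchy (seq x) (seq y) (cauchy x) (cauchy y))

_*_ : ℝ → ℝ → ℝ
x * y = mkℝ (λ n → seq x n ℚ.* seq y n)
  (*-isCauchy (seq x) (seq y) (cauchy x) (cauchy y))

ℕ₊ : Pred ℝ 0ℓ
ℕ₊ x = ∃[ k ] (0 ℕ.< k × x ≈ fromℕ k)

sumset : Pred ℝ 0ℓ → Pred ℝ 0ℓ
sumset A z = ∃[ x ] ∃[ y ] (x ∈ A × y ∈ A × z ≈ x + y)

productset : Pred ℝ 0ℓ → Pred ℝ 0ℓ
productset A z = ∃[ x ] ∃[ y ] (x ∈ A × y ∈ A × z ≈ x * y)

-- A is finite with exactly n elements up to _≈_.  The equivalence also makes
-- A closed under _≈_, so A is a genuine subset of the reals.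
HasSize : Pred ℝ 0ℓ → ℕ → Set
HasSize A n = Σ[ f ∈ (Fin n → ℝ) ]
  (Injective _≡_ _≈_ f × (∀ x → x ∈ A ⇔ (∃[ i ] x ≈ f i)))

SPP[_] : Pred ℝ 0ℓ → ℕ → Pred (ℕ × ℕ) (suc 0ℓ)
SPP[ X ] n (s , p) = Σ[ A ∈ Pred ℝ 0ℓ ]
  (A ⊆ X × HasSize A n × HasSize (sumset A) s × HasSize (productset A) p)

SPP : ℕ → Pred (ℕ × ℕ) (suc 0ℓ)
SPP = SPP[ ℕ₊ ]

module Submission where

-- For a < b < c < d the sums form a chain aa < ab < ac < ad < bd < cd < dd (writing
-- xy for x + y), and the three missing ones bb < bc < cc can only coincide with ac,
-- ad or bd; the same holds for products.  At most eight products therefore means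
-- two coincidences, i.e. A is a dilate of {1, r, r², r³}, {1, r, r², r⁴} or
-- {1, r², r³, r⁴}.  Since x < z < y and x + y = z + w imply xy < zw, a coincidence of
-- sums is then only possible in four cases, in which r is the golden ratio, the
-- plastic number or the tribonacci constant; none of these is rational, and no set
-- A admits two of the four.  Order arguments take place under double negation,
-- which is harmless as the conclusions are decidable.

open import Algebra.Bundles using (CommutativeRing; CommutativeSemigroup)
import Algebra.Properties.AbelianGroup as AbelianGroupProperties
import Algebra.Properties.CommutativeSemigroup as CommutativeSemigroupProperties
import Algebra.Solver.Ring.NaturalCoefficients.Default as SemiringSolver
open import Algebra.Structures using (IsCommutativeRing)
open import Data.Fin.Base as Fin using (Fin)
import Data.Fin.Properties as Fin
open import Data.Integer.Base as ℤ using ()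
import Data.Integer.Properties as ℤ
open import Data.List.Base
  using (List; []; _∷_; _++_; map; length; lookup; tabulate; deduplicate; cartesianProductWith)
import Data.List.Membership.Propositional.Properties as ∈
import Data.List.Membership.Setoid as SetoidMembership
import Data.List.Properties as List
open import Data.List.Relation.Binary.Permutation.Propositional as ↭ using (_↭_; ↭-sym)
open import Data.List.Relation.Binary.Permutation.Propositional.Properties
  using (All-resp-↭; Any-resp-↭; ↭-length)
open import Data.List.Relation.Unary.All as All using (All; []; _∷_)
open import Data.List.Relation.Unary.AllPairs as AllPairs using (AllPairs; []; _∷_)
import Data.List.Relation.Unary.AllPairs.Properties as AllPairs
open import Data.List.Relation.Unary.Any as Any using (here; there)
import Data.List.Relation.Unary.Any.Properties as Any
open import Data.List.Relation.Unary.Linked using (Linked; [-]; _∷_)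
open import Data.List.Relation.Unary.Linked.Properties using (Linked⇒AllPairs)
import Data.List.Relation.Unary.Unique.DecPropositional.Properties as Unique
open import Data.Nat.Base as ℕ using (ℕ; zero; suc; _≤_; z≤n; s≤s)
import Data.Nat.Coprimality as Coprimality
open import Data.Nat.Coprimality using (Coprime; coprime-/gcd; coprime-divisor)
open import Data.Nat.Divisibility using (_∣_; ∣m+n∣m⇒∣n; m∣m*n; n∣m*n; ∣1⇒≡1; ∣-trans)
open import Data.Nat.DivMod using (m/n*n≡m)
open import Data.Nat.GCD using (gcd; gcd[m,n]∣m; gcd[m,n]∣n; gcd[m,n]≢0)
import Data.Nat.Properties as ℕ
open import Data.Nat.Tactic.RingSolver using (solve-∀)
open import Data.Product.Base using (Σ-syntax; ∃-syntax; _×_; _,_; proj₁; proj₂)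
import Data.Product.Properties as Product
open import Data.Rational.Base as ℚ using (ℚ; 0ℚ; 1ℚ; ½; ∣_∣; 1/_)
import Data.Rational.Properties as ℚ
import Data.Rational.Solver as ℚ-Solver
import Data.Rational.Unnormalised.Base as ℚᵘ
import Data.Rational.Unnormalised.Properties as ℚᵘ
open import Data.Sum.Base using (_⊎_; inj₁; inj₂; [_,_]′; map₁)
open import Function.Base using (_∘_; id)
open import Function.Bundles using (_⇔_; mk⇔; module Equivalence)
open import Function.Definitions using (Injective)
open import Level using (0ℓ)
open import Relation.Binary.Bundles using (Setoid)
open import Relation.Binary.Definitions using (tri<; tri≈; tri>; DecidableEquality)
open import Relation.Binary.PropositionalEquality as ≡
  using (_≡_; refl; cong; cong₂; subst; subst₂)
import Relation.Binary.PropositionalEquality.Properties as ≡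
import Relation.Binary.Reasoning.Setoid as ≈-Reasoning
open import Relation.Binary.Structures using (IsEquivalence; IsStrictPartialOrder)
open import Relation.Nullary using (¬_; Dec; yes; no; contradiction)
open import Relation.Nullary.Decidable
  using (True; toWitness; map′; decidable-stable; ¬?; _×-dec_; _⊎-dec_; _→-dec_)
open import Relation.Unary using (Pred; _∈_; _⊆_; _≐_; _∪_; ｛_｝)

-- Counting in a setoid

-- Addition and multiplication enter through one notion of ordered semigroup, so the counting is
-- done once and only the comparison of the two operations uses a ring. In the exceptional cases the
-- ratio r satisfies 1 + r^3 = 2r^2, 1 + r^4 = r^2 + r^3 or 1 + r^4 = 2r^3. Each has leading and
-- constant coefficient 1 and the root 1, which is why rational solutions collapse to equal
-- elements. Only the first has to be solved in the reals: 1 + φ^3 = 2φ^2 is the single coincidence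
-- of sums both in {1, φ, φ^2, φ^3} and in {1, φ^2, φ^3, φ^4}, which have seven and eight products.
-- Cauchy reals cannot be compared by evaluation, so the sizes of these sets are computed with pairs
-- of natural numbers standing for m + nφ and carried over by an injective map that respects sums
-- and products.

module Cardinality (S : Setoid 0ℓ 0ℓ) where

  open Setoid S renaming (refl to ≈-refl; sym to ≈-sym; trans to ≈-trans)
  open SetoidMembership S using () renaming (_∈_ to _∈ₗ_)
  open Equivalence using (to; from)

  -- Over the reals, Size is HasSize, and Pairwise _+_ and Pairwise _*_ are sumset
  -- and productset.
  Size : Pred Carrier 0ℓ → ℕ → Set
  Size A n = Σ[ f ∈ (Fin n → Carrier) ]
    (Injective _≡_ _≈_ f × (∀ x → x ∈ A ⇔ (∃[ i ] x ≈ f i)))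

  Pairwise : (Carrier → Carrier → Carrier) → Pred Carrier 0ℓ → Pred Carrier 0ℓ
  Pairwise _∙_ A z = ∃[ x ] ∃[ y ] (x ∈ A × y ∈ A × z ≈ x ∙ y)

  Distinct : List Carrier → Set
  Distinct = AllPairs _≉_

  _Lists_ : List Carrier → Pred Carrier 0ℓ → Set
  xs Lists A = ∀ x → x ∈ A ⇔ x ∈ₗ xs

  lookup-injective : ∀ {xs} → Distinct xs → ∀ i j → lookup xs i ≈ lookup xs j → i ≡ j
  lookup-injective (_ ∷ _)    Fin.zero    Fin.zero    _ = refl
  lookup-injective (x≉ ∷ _)   Fin.zero    (Fin.suc j) e =
    contradiction e (All.lookup x≉ (∈.∈-lookup j))
  lookup-injective (x≉ ∷ _)   (Fin.suc i) Fin.zero    e =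
    contradiction (≈-sym e) (All.lookup x≉ (∈.∈-lookup i))
  lookup-injective (_ ∷ dist) (Fin.suc i) (Fin.suc j) e = cong Fin.suc (lookup-injective dist i j e)

  Size⇒Lists : ∀ {A n} → Size A n → ∃[ xs ] (length xs ≡ n × Distinct xs × xs Lists A)
  Size⇒Lists (f , f-inj , enum) =
    tabulate f , List.length-tabulate f , AllPairs.tabulate⁺ (λ i≢j → i≢j ∘ f-inj) , λ x → mk⇔
      (λ x∈A → let i , x≈ = to (enum x) x∈A in Any.tabulate⁺ i x≈)
      (λ x∈ → from (enum x) (Any.tabulate⁻ x∈))

  -- Membership in an enumerated set makes the undecidable _≈_ decidable.
  ≈-dec : ∀ {B n x y} → Size B n → x ∈ B → y ∈ B → Dec (x ≈ y)
  ≈-dec {x = x} {y} (f , f-inj , enum) x∈B y∈B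
    with i , x≈ ← to (enum x) x∈B | j , y≈ ← to (enum y) y∈B =
    map′ (λ { refl → ≈-trans x≈ (≈-sym y≈) })
         (λ x≈y → f-inj (≈-trans (≈-sym x≈) (≈-trans x≈y y≈)))
         (i Fin.≟ j)

  -- Pigeonhole: the index of an entry in the enumeration of `B` is an injective function of its
  -- position. Every lower bound on a size rests on this.
  distinct⇒length≤ : ∀ {B n xs} → Size B n → All B xs → Distinct xs → length xs ≤ n
  distinct⇒length≤ {B} {n} {xs} (f , f-inj , enum) xs⊆B distinct =
    Fin.injective⇒≤ {f = proj₁ ∘ code} λ {i} {j} eq → lookup-injective distinct i j
      (≈-trans (proj₂ (code i)) (≈-trans (reflexive (cong f eq)) (≈-sym (proj₂ (code j)))))
    where
    code : ∀ i → ∃[ k ] lookup xs i ≈ f k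
    code i = to (enum (lookup xs i)) (All.lookup xs⊆B (∈.∈-lookup i))

  -- Pigeonhole in the other direction: each enumerated element goes to a position of the list that
  -- holds an equal one.
  covers⇒≤length : ∀ {B n xs} → Size B n → (∀ {x} → x ∈ B → x ∈ₗ xs) → n ≤ length xs
  covers⇒≤length {B} {n} {xs} (f , f-inj , enum) covers =
    Fin.injective⇒≤ {f = Any.index ∘ code} λ {i} {j} eq → f-inj
      (≈-trans (Any.lookup-index (code i))
        (≈-trans (reflexive (cong (lookup xs) eq)) (≈-sym (Any.lookup-index (code j)))))
    where
    code : ∀ i → f i ∈ₗ xs
    code i = covers (from (enum (f i)) (i , ≈-refl))

  -- One entry per unordered pair, so the length is n(n+1)/2; for n = 1, 2, 3, 4 this yields the
  -- upper bounds 1, 3, 6, 10.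
  pairProducts : (Carrier → Carrier → Carrier) → List Carrier → List Carrier
  pairProducts _∙_ []       = []
  pairProducts _∙_ (x ∷ xs) = map (x ∙_) (x ∷ xs) ++ pairProducts _∙_ xs

  module _ {_∙_ : Carrier → Carrier → Carrier}
    (∙-cong : ∀ {x y u v} → x ≈ y → u ≈ v → (x ∙ u) ≈ (y ∙ v))
    (∙-comm : ∀ x y → (x ∙ y) ≈ (y ∙ x)) where

    pairProducts-complete : ∀ {x y xs} → x ∈ₗ xs → y ∈ₗ xs → (x ∙ y) ∈ₗ pairProducts _∙_ xs
    pairProducts-complete (here x≈h) y∈ =
      Any.++⁺ˡ (Any.map⁺ (Any.map (∙-cong x≈h) y∈))
    pairProducts-complete {x} {y} (there x∈) (here y≈h) =
      Any.++⁺ˡ (Any.map⁺ (there (Any.map (λ x≈z → ≈-trans (∙-comm x y) (∙-cong y≈h x≈z)) x∈)))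
    pairProducts-complete {xs = h ∷ xs} (there x∈) (there y∈) =
      Any.++⁺ʳ (map (h ∙_) (h ∷ xs)) (pairProducts-complete x∈ y∈)

    Pairwise-size≤ : ∀ {A xs n} → xs Lists A → Size (Pairwise _∙_ A) n →
      n ≤ length (pairProducts _∙_ xs)
    Pairwise-size≤ lists size = covers⇒≤length size λ (x , y , x∈A , y∈A , z≈xy) →
      Any.map (≈-trans z≈xy) (pairProducts-complete (to (lists x) x∈A) (to (lists y) y∈A))

  module Sorting {_<_ : Carrier → Carrier → Set}
    (<-isStrictPartialOrder : IsStrictPartialOrder _≈_ _<_)
    (<-connex : ∀ {x y} → ¬ x < y → ¬ y < x → x ≈ y) where

    open IsStrictPartialOrder <-isStrictPartialOrder using () renaming (trans to <-trans)

    -- The order of `x` and `y` cannot be decided, but either order would let `k` be refuted; with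
    -- both excluded, `<-connex` makes them equal, against distinctness.
    insert-sorted : ∀ x xs → All (x ≉_) xs → AllPairs _<_ xs →
      ¬ ¬ (∃[ ys ] (ys ↭ x ∷ xs × AllPairs _<_ ys))
    insert-sorted x []       _            _               k = k (x ∷ [] , ↭.refl , [] ∷ [])
    insert-sorted x (y ∷ ys) (x≉y ∷ x≉ys) (y<ys ∷ sorted) k = x≉y (<-connex
      (λ x<y → k (x ∷ y ∷ ys , ↭.refl , (x<y ∷ All.map (<-trans x<y) y<ys) ∷ y<ys ∷ sorted))
      (λ y<x → insert-sorted x ys x≉ys sorted λ (zs , zs↭ , zs-sorted) →
        k (y ∷ zs , ↭.trans (↭.prep y zs↭) (↭.swap y x ↭.refl)
          , All-resp-↭ (↭-sym zs↭) (y<x ∷ y<ys) ∷ zs-sorted)))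

    sort : ∀ xs → Distinct xs → ¬ ¬ (∃[ ys ] (ys ↭ xs × AllPairs _<_ ys))
    sort []       _                 k = k ([] , ↭.refl , [])
    sort (x ∷ xs) (x≉ ∷ distinct) k = sort xs distinct λ (ys , ys↭ , sorted) →
      insert-sorted x ys (All-resp-↭ (↭-sym ys↭) x≉) sorted λ (zs , zs↭ , zs-sorted) →
        k (zs , ↭.trans zs↭ (↭.prep x ys↭) , zs-sorted)

    Size⇒sorted : ∀ {A n} → Size A n →
      ¬ ¬ (∃[ xs ] (length xs ≡ n × AllPairs _<_ xs × xs Lists A))
    Size⇒sorted size k with xs , len , distinct , lists ← Size⇒Lists size =
      sort xs distinct λ (ys , ys↭ , sorted) →
        k (ys , ≡.trans (↭-length ys↭) len , sorted , λ x → mk⇔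
          (λ x∈A → Any-resp-↭ (↭-sym ys↭) (to (lists x) x∈A))
          (λ x∈ys → from (lists x) (Any-resp-↭ ys↭ x∈ys)))

-- Coincidences among the products of few elements

-- Abstracts what addition and multiplication of positive reals share; `Positive` marks elements
-- whose translations are strictly monotone.
record OrderedSemigroup : Set₁ where
  field
    commutativeSemigroup : CommutativeSemigroup 0ℓ 0ℓ

  open CommutativeSemigroup commutativeSemigroup public

  field
    _<_                   : Carrier → Carrier → Set
    <-isStrictPartialOrder : IsStrictPartialOrder _≈_ _<_
    <-connex              : ∀ {x y} → ¬ x < y → ¬ y < x → x ≈ y
    Positive              : Pred Carrier 0ℓ
    Positive-∙            : ∀ {x y} → Positive x → Positive y → Positive (x ∙ y)
    ∙-monoʳ-<             : ∀ {z x y} → Positive z → x < y → (z ∙ x) < (z ∙ y)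

module Coincidences (𝓢 : OrderedSemigroup) where

  open OrderedSemigroup 𝓢 renaming (refl to ≈-refl; sym to ≈-sym; trans to ≈-trans)
  open CommutativeSemigroupProperties commutativeSemigroup
    using (interchange; x∙yz≈y∙xz; x∙yz≈yx∙z)
  open IsStrictPartialOrder <-isStrictPartialOrder using (<-respʳ-≈; <-respˡ-≈)
    renaming (trans to <-trans; irrefl to <⇒≉)
  open Cardinality setoid

  -- Since bb lies strictly between ab and bd, bc between ac and bd, and cc between ac and cd, these
  -- five equations are all that can occur.
  data Coincidence (a b c d : Carrier) : Set where
    ⟨ac≈bb⟩ : a ∙ c ≈ b ∙ b → Coincidence a b c d
    ⟨bd≈cc⟩ : b ∙ d ≈ c ∙ c → Coincidence a b c d
    ⟨ad≈bc⟩ : a ∙ d ≈ b ∙ c → Coincidence a b c d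
    ⟨ad≈bb⟩ : a ∙ d ≈ b ∙ b → Coincidence a b c d
    ⟨ad≈cc⟩ : a ∙ d ≈ c ∙ c → Coincidence a b c d

  -- Written multiplicatively, the constructors are the dilates of {1, r, r², r³}, {1, r, r², r⁴}
  -- and {1, r², r³, r⁴}, in this order.
  data DoubleCoincidence (a b c d : Carrier) : Set where
    progression : a ∙ c ≈ b ∙ b → b ∙ d ≈ c ∙ c → a ∙ d ≈ b ∙ c → DoubleCoincidence a b c d
    ⟨ac≈bb,ad≈cc⟩ : a ∙ c ≈ b ∙ b → a ∙ d ≈ c ∙ c → DoubleCoincidence a b c d
    ⟨bd≈cc,ad≈bb⟩ : b ∙ d ≈ c ∙ c → a ∙ d ≈ b ∙ b → DoubleCoincidence a b c d

  >⇒≉ : ∀ {x y} → y < x → x ≉ y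
  >⇒≉ y<x x≈y = <⇒≉ (≈-sym x≈y) y<x

  ∙-monoˡ-< : ∀ {z x y} → Positive z → x < y → (x ∙ z) < (y ∙ z)
  ∙-monoˡ-< {z} {x} {y} 0<z x<y =
    <-respʳ-≈ (comm z y) (<-respˡ-≈ (comm z x) (∙-monoʳ-< 0<z x<y))

  -- Cancellation comes from strict monotonicity and connexity, without inverses.
  ∙-cancelˡ : ∀ {z x y} → Positive z → z ∙ x ≈ z ∙ y → x ≈ y
  ∙-cancelˡ 0<z zx≈zy = <-connex
    (λ x<y → <⇒≉ zx≈zy (∙-monoʳ-< 0<z x<y))
    (λ y<x → >⇒≉ (∙-monoʳ-< 0<z y<x) zx≈zy)

  -- Multiplying the hypotheses gives (ad)(bc) = (bc)(bc), and bc cancels. The next two lemmas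
  -- cancel a and d in the same way, so any two of the three equations imply the third.
  ac≈bb∧bd≈cc⇒ad≈bc : ∀ {a b c d} → Positive b → Positive c →
    a ∙ c ≈ b ∙ b → b ∙ d ≈ c ∙ c → a ∙ d ≈ b ∙ c
  ac≈bb∧bd≈cc⇒ad≈bc {a} {b} {c} {d} 0<b 0<c ac≈bb bd≈cc = ∙-cancelˡ (Positive-∙ 0<b 0<c) (begin
    (b ∙ c) ∙ (a ∙ d)  ≈⟨ ∙-congʳ (comm b c) ⟩
    (c ∙ b) ∙ (a ∙ d)  ≈⟨ comm (c ∙ b) (a ∙ d) ⟩
    (a ∙ d) ∙ (c ∙ b)  ≈⟨ interchange a d c b ⟩
    (a ∙ c) ∙ (d ∙ b)  ≈⟨ ∙-cong ac≈bb (≈-trans (comm d b) bd≈cc) ⟩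
    (b ∙ b) ∙ (c ∙ c)  ≈⟨ interchange b b c c ⟩
    (b ∙ c) ∙ (b ∙ c)  ∎)
    where open ≈-Reasoning setoid

  ac≈bb∧ad≈bc⇒bd≈cc : ∀ {a b c d} → Positive a →
    a ∙ c ≈ b ∙ b → a ∙ d ≈ b ∙ c → b ∙ d ≈ c ∙ c
  ac≈bb∧ad≈bc⇒bd≈cc {a} {b} {c} {d} 0<a ac≈bb ad≈bc = ∙-cancelˡ 0<a (begin
    a ∙ (b ∙ d)  ≈⟨ x∙yz≈y∙xz a b d ⟩
    b ∙ (a ∙ d)  ≈⟨ ∙-congˡ ad≈bc ⟩
    b ∙ (b ∙ c)  ≈⟨ assoc b b c ⟨
    (b ∙ b) ∙ c  ≈⟨ ∙-congʳ ac≈bb ⟨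
    (a ∙ c) ∙ c  ≈⟨ assoc a c c ⟩
    a ∙ (c ∙ c)  ∎)
    where open ≈-Reasoning setoid

  bd≈cc∧ad≈bc⇒ac≈bb : ∀ {a b c d} → Positive d →
    b ∙ d ≈ c ∙ c → a ∙ d ≈ b ∙ c → a ∙ c ≈ b ∙ b
  bd≈cc∧ad≈bc⇒ac≈bb {a} {b} {c} {d} 0<d bd≈cc ad≈bc = ∙-cancelˡ 0<d (begin
    d ∙ (a ∙ c)  ≈⟨ x∙yz≈yx∙z d a c ⟩
    (a ∙ d) ∙ c  ≈⟨ ∙-congʳ ad≈bc ⟩
    (b ∙ c) ∙ c  ≈⟨ assoc b c c ⟩
    b ∙ (c ∙ c)  ≈⟨ ∙-congˡ bd≈cc ⟨
    b ∙ (b ∙ d)  ≈⟨ assoc b b d ⟨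
    (b ∙ b) ∙ d  ≈⟨ comm (b ∙ b) d ⟩
    d ∙ (b ∙ b)  ∎)
    where open ≈-Reasoning setoid

  module _ {A : Pred Carrier 0ℓ} (A⊆Positive : A ⊆ Positive)
    {m} (size : Size (Pairwise _∙_ A) m) where

    product∈ : ∀ {x y} → x ∈ A → y ∈ A → x ∙ y ∈ Pairwise _∙_ A
    product∈ x∈A y∈A = _ , _ , x∈A , y∈A , ≈-refl

    increasing⇒distinct : ∀ {xs} → Linked _<_ xs → Distinct xs
    increasing⇒distinct = AllPairs.map (λ x<y x≈y → <⇒≉ x≈y x<y) ∘ Linked⇒AllPairs <-trans

    size₂ : ∀ {a b} → a ∈ A → b ∈ A → a < b → 3 ≤ m
    size₂ a∈A b∈A a<b = distinct⇒length≤ size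
      (product∈ a∈A a∈A ∷ product∈ a∈A b∈A ∷ product∈ b∈A b∈A ∷ [])
      (increasing⇒distinct (∙-monoʳ-< (A⊆Positive a∈A) a<b ∷ ∙-monoˡ-< (A⊆Positive b∈A) a<b ∷ [-]))

    module Triple {a b c} (a∈A : a ∈ A) (b∈A : b ∈ A) (c∈A : c ∈ A) (a<b : a < b) (b<c : b < c) where

      private
        0<a : Positive a
        0<a = A⊆Positive a∈A
        0<b : Positive b
        0<b = A⊆Positive b∈A
        0<c : Positive c
        0<c = A⊆Positive c∈A

      chain₃ : List Carrier
      chain₃ = a ∙ a ∷ a ∙ b ∷ a ∙ c ∷ b ∙ c ∷ c ∙ c ∷ []

      chain₃⊆ : All (Pairwise _∙_ A) chain₃
      chain₃⊆ = product∈ a∈A a∈A ∷ product∈ a∈A b∈A ∷ product∈ a∈A c∈A ∷ product∈ b∈A c∈A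
        ∷ product∈ c∈A c∈A ∷ []

      chain₃-distinct : Distinct chain₃
      chain₃-distinct = increasing⇒distinct
        ( ∙-monoʳ-< 0<a a<b ∷ ∙-monoʳ-< 0<a b<c ∷ ∙-monoˡ-< 0<c a<b ∷ ∙-monoˡ-< 0<c b<c ∷ [-] )

      size₃ : 5 ≤ m
      size₃ = distinct⇒length≤ size chain₃⊆ chain₃-distinct

      -- As bb lies strictly between ab and bc, only ac can equal it; otherwise bb is a sixth
      -- element beside the chain.
      m≤5⇒ac≈bb : m ≤ 5 → a ∙ c ≈ b ∙ b
      m≤5⇒ac≈bb m≤5 with ≈-dec size (product∈ a∈A c∈A) (product∈ b∈A b∈A)
      ... | yes ac≈bb = ac≈bb
      ... | no  ac≉bb = contradiction m≤5 (ℕ.<⇒≱ (distinct⇒length≤ size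
        (product∈ b∈A b∈A ∷ chain₃⊆)
        (( >⇒≉ (<-trans aa<ab ab<bb) ∷ >⇒≉ ab<bb ∷ ac≉bb ∘ ≈-sym
         ∷ (λ e → <⇒≉ e bb<bc) ∷ (λ e → <⇒≉ e (<-trans bb<bc bc<cc)) ∷ []) ∷ chain₃-distinct)))
        where
        aa<ab = ∙-monoʳ-< 0<a a<b
        ab<bb = ∙-monoˡ-< 0<b a<b
        bb<bc = ∙-monoʳ-< 0<b b<c
        bc<cc = ∙-monoˡ-< 0<c b<c

    module Quadruple {a b c d} (a∈A : a ∈ A) (b∈A : b ∈ A) (c∈A : c ∈ A) (d∈A : d ∈ A)
      (a<b : a < b) (b<c : b < c) (c<d : c < d) where

      private
        0<a : Positive a
        0<a = A⊆Positive a∈A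
        0<b : Positive b
        0<b = A⊆Positive b∈A
        0<c : Positive c
        0<c = A⊆Positive c∈A
        0<d : Positive d
        0<d = A⊆Positive d∈A

        aa<ab = ∙-monoʳ-< 0<a a<b
        ab<ac = ∙-monoʳ-< 0<a b<c
        ac<ad = ∙-monoʳ-< 0<a c<d
        ad<bd = ∙-monoˡ-< 0<d a<b
        bd<cd = ∙-monoˡ-< 0<d b<c
        cd<dd = ∙-monoˡ-< 0<d c<d
        ab<bb = ∙-monoˡ-< 0<b a<b
        ac<bc = ∙-monoˡ-< 0<c a<b
        bb<bc = ∙-monoʳ-< 0<b b<c
        bc<bd = ∙-monoʳ-< 0<b c<d
        bc<cc = ∙-monoˡ-< 0<c b<c
        cc<cd = ∙-monoʳ-< 0<c c<d

        ab<bc = <-trans ab<ac ac<bc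
        ac<cc = <-trans ac<bc bc<cc
        bb<bd = <-trans bb<bc bc<bd

        <⇒≉′ : ∀ {x y} → x < y → x ≉ y
        <⇒≉′ x<y x≈y = <⇒≉ x≈y x<y

      chain : List Carrier
      chain = a ∙ a ∷ a ∙ b ∷ a ∙ c ∷ a ∙ d ∷ b ∙ d ∷ c ∙ d ∷ d ∙ d ∷ []

      chain⊆ : All (Pairwise _∙_ A) chain
      chain⊆ = product∈ a∈A a∈A ∷ product∈ a∈A b∈A ∷ product∈ a∈A c∈A ∷ product∈ a∈A d∈A
        ∷ product∈ b∈A d∈A ∷ product∈ c∈A d∈A ∷ product∈ d∈A d∈A ∷ []

      chain-distinct : Distinct chain
      chain-distinct = increasing⇒distinct
        (aa<ab ∷ ab<ac ∷ ac<ad ∷ ad<bd ∷ bd<cd ∷ cd<dd ∷ [-])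

      size₄ : 7 ≤ m
      size₄ = distinct⇒length≤ size chain⊆ chain-distinct

      -- The three products missing from the chain are bb < bc < cc; each of
      -- them can only coincide with the chain elements ac, ad and bd.

      bb∉chain : ¬ (a ∙ c ≈ b ∙ b ⊎ a ∙ d ≈ b ∙ b) → All (b ∙ b ≉_) chain
      bb∉chain new =
        >⇒≉ (<-trans aa<ab ab<bb) ∷ >⇒≉ ab<bb ∷ new ∘ inj₁ ∘ ≈-sym ∷ new ∘ inj₂ ∘ ≈-sym
        ∷ <⇒≉′ bb<bd ∷ <⇒≉′ (<-trans bb<bd bd<cd) ∷ <⇒≉′ (<-trans bb<bd (<-trans bd<cd cd<dd)) ∷ []

      bc∉chain : ¬ (a ∙ d ≈ b ∙ c) → All (b ∙ c ≉_) chain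
      bc∉chain new =
        >⇒≉ (<-trans aa<ab ab<bc) ∷ >⇒≉ ab<bc ∷ >⇒≉ ac<bc ∷ new ∘ ≈-sym
        ∷ <⇒≉′ bc<bd ∷ <⇒≉′ (<-trans bc<bd bd<cd) ∷ <⇒≉′ (<-trans bc<bd (<-trans bd<cd cd<dd)) ∷ []

      cc∉chain : ¬ (b ∙ d ≈ c ∙ c ⊎ a ∙ d ≈ c ∙ c) → All (c ∙ c ≉_) chain
      cc∉chain new =
        >⇒≉ (<-trans aa<ab (<-trans ab<ac ac<cc)) ∷ >⇒≉ (<-trans ab<ac ac<cc) ∷ >⇒≉ ac<cc
        ∷ new ∘ inj₂ ∘ ≈-sym ∷ new ∘ inj₁ ∘ ≈-sym
        ∷ <⇒≉′ cc<cd ∷ <⇒≉′ (<-trans cc<cd cd<dd) ∷ []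

      private
        bb-old? : Dec (a ∙ c ≈ b ∙ b ⊎ a ∙ d ≈ b ∙ b)
        bb-old? = ≈-dec size (product∈ a∈A c∈A) (product∈ b∈A b∈A)
          ⊎-dec ≈-dec size (product∈ a∈A d∈A) (product∈ b∈A b∈A)

        bc-old? : Dec (a ∙ d ≈ b ∙ c)
        bc-old? = ≈-dec size (product∈ a∈A d∈A) (product∈ b∈A c∈A)

        cc-old? : Dec (b ∙ d ≈ c ∙ c ⊎ a ∙ d ≈ c ∙ c)
        cc-old? = ≈-dec size (product∈ b∈A d∈A) (product∈ c∈A c∈A)
          ⊎-dec ≈-dec size (product∈ a∈A d∈A) (product∈ c∈A c∈A)

      m≤9⇒coincidence : m ≤ 9 → Coincidence a b c d
      m≤9⇒coincidence m≤9 with bb-old? | bc-old? | cc-old?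
      ... | yes (inj₁ e) | _     | _            = ⟨ac≈bb⟩ e
      ... | yes (inj₂ e) | _     | _            = ⟨ad≈bb⟩ e
      ... | no _         | yes e | _            = ⟨ad≈bc⟩ e
      ... | no _         | no _  | yes (inj₁ e) = ⟨bd≈cc⟩ e
      ... | no _         | no _  | yes (inj₂ e) = ⟨ad≈cc⟩ e
      -- With bb, bc and cc all new, the chain of seven grows to ten.
      ... | no bb        | no bc | no cc        = contradiction m≤9 (ℕ.<⇒≱ (distinct⇒length≤ size
        (product∈ b∈A b∈A ∷ product∈ b∈A c∈A ∷ product∈ c∈A c∈A ∷ chain⊆)
        ( (<⇒≉′ bb<bc ∷ <⇒≉′ (<-trans bb<bc bc<cc) ∷ bb∉chain bb) ∷ (<⇒≉′ bc<cc ∷ bc∉chain bc)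
        ∷ cc∉chain cc ∷ chain-distinct)))

      -- Two new elements among bb, bc, cc would make nine, so at least two are old. No two of them
      -- can both equal ad, since bb < bc < cc; the remaining combinations are the three
      -- constructors, up to deriving the third equation of a progression.
      m≤8⇒doubleCoincidence : m ≤ 8 → DoubleCoincidence a b c d
      m≤8⇒doubleCoincidence m≤8 with bb-old? | bc-old? | cc-old?
      ... | yes (inj₁ e) | yes f | _            = progression e (ac≈bb∧ad≈bc⇒bd≈cc 0<a e f) f
      ... | yes (inj₂ e) | yes f | _            = contradiction (≈-trans (≈-sym e) f) (<⇒≉′ bb<bc)
      ... | yes (inj₁ e) | no _  | yes (inj₁ g) = progression e g (ac≈bb∧bd≈cc⇒ad≈bc 0<b 0<c e g)
      ... | yes (inj₁ e) | no _  | yes (inj₂ g) = ⟨ac≈bb,ad≈cc⟩ e g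
      ... | yes (inj₂ e) | no _  | yes (inj₁ g) = ⟨bd≈cc,ad≈bb⟩ g e
      ... | yes (inj₂ e) | no _  | yes (inj₂ g) =
        contradiction (≈-trans (≈-sym e) g) (<⇒≉′ (<-trans bb<bc bc<cc))
      ... | no _         | yes f | yes (inj₁ g) = progression (bd≈cc∧ad≈bc⇒ac≈bb 0<d g f) g f
      ... | no _         | yes f | yes (inj₂ g) = contradiction (≈-trans (≈-sym f) g) (<⇒≉′ bc<cc)
      ... | yes _        | no bc | no cc        = contradiction m≤8 (ℕ.<⇒≱ (distinct⇒length≤ size
        (product∈ b∈A c∈A ∷ product∈ c∈A c∈A ∷ chain⊆)
        ((<⇒≉′ bc<cc ∷ bc∉chain bc) ∷ cc∉chain cc ∷ chain-distinct)))
      ... | no bb        | yes _ | no cc        = contradiction m≤8 (ℕ.<⇒≱ (distinct⇒length≤ size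
        (product∈ b∈A b∈A ∷ product∈ c∈A c∈A ∷ chain⊆)
        ((<⇒≉′ (<-trans bb<bc bc<cc) ∷ bb∉chain bb) ∷ cc∉chain cc ∷ chain-distinct)))
      ... | no bb        | no bc | _            = contradiction m≤8 (ℕ.<⇒≱ (distinct⇒length≤ size
        (product∈ b∈A b∈A ∷ product∈ b∈A c∈A ∷ chain⊆)
        ((<⇒≉′ bb<bc ∷ bb∉chain bb) ∷ bc∉chain bc ∷ chain-distinct)))

-- Homogeneous forms with no nontrivial rational root

coprime-power-divisor : ∀ {m n} k → Coprime m n → m ∣ n ℕ.^ k → m ≡ 1
coprime-power-divisor zero    m⊥n m∣1     = ∣1⇒≡1 m∣1
coprime-power-divisor (suc k) m⊥n m∣n*n^k =
  coprime-power-divisor k m⊥n (coprime-divisor m⊥n m∣n*n^k)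

module _ {n : ℕ} {q : ℕ → ℕ → ℕ} (q-homogeneous : ∀ x y g → q (x ℕ.* g) (y ℕ.* g) ≡ q x y ℕ.* g ℕ.^ n) where

  private
    -- The degree of the form x^N + y^N - x y q(x, y), two more than that of `q`.
    N : ℕ
    N = suc (suc n)

  -- `x` divides every term except y^N, hence that one too, and coprimality leaves only 1.
  coprime-root≡1 : ∀ x y → Coprime x y →
    x ℕ.^ N ℕ.+ y ℕ.^ N ≡ x ℕ.* y ℕ.* q x y → x ≡ 1
  coprime-root≡1 x y x⊥y root = coprime-power-divisor N x⊥y
    (∣m+n∣m⇒∣n (subst (x ∣_) (≡.sym (≡.trans root (ℕ.*-assoc x y (q x y)))) (m∣m*n _)) (m∣m*n _))

  -- The extreme coefficients are ±1, so in lowest terms the only positive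
  -- rational root is 1.
  root⇒≡ : ∀ b c .{{_ : ℕ.NonZero b}} →
    b ℕ.^ N ℕ.+ c ℕ.^ N ≡ b ℕ.* c ℕ.* q b c → b ≡ c
  root⇒≡ b c root = ≡.trans (≡.sym b≡xg) (≡.trans (cong (ℕ._* g) (≡.trans x≡1 (≡.sym y≡1))) c≡yg)
    where
    g : ℕ
    g = gcd b c
    instance
      g-nonZero : ℕ.NonZero g
      g-nonZero = ℕ.≢-nonZero (gcd[m,n]≢0 b c (inj₁ (ℕ.≢-nonZero⁻¹ b)))
      g^N-nonZero : ℕ.NonZero (g ℕ.^ N)
      g^N-nonZero = ℕ.m^n≢0 g N
    x y : ℕ
    x = b ℕ./ g
    y = c ℕ./ g
    b≡xg : x ℕ.* g ≡ b
    b≡xg = m/n*n≡m (gcd[m,n]∣m b c)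
    c≡yg : y ℕ.* g ≡ c
    c≡yg = m/n*n≡m (gcd[m,n]∣n b c)

    power-distrib : ∀ m k → (m ℕ.* g) ℕ.^ k ≡ m ℕ.^ k ℕ.* g ℕ.^ k
    power-distrib m zero    = refl
    power-distrib m (suc k) = ≡.trans (cong (m ℕ.* g ℕ.*_) (power-distrib m k))
      (interchange m g (m ℕ.^ k) (g ℕ.^ k))
      where open CommutativeSemigroupProperties ℕ.*-commutativeSemigroup

    collect : ∀ x y g q r → x ℕ.* g ℕ.* (y ℕ.* g) ℕ.* (q ℕ.* r) ≡ x ℕ.* y ℕ.* q ℕ.* (g ℕ.* (g ℕ.* r))
    collect = solve-∀

    -- Both sides are homogeneous of degree `N`, so the factor g^N cancels.
    reduced : x ℕ.^ N ℕ.+ y ℕ.^ N ≡ x ℕ.* y ℕ.* q x y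
    reduced = ℕ.*-cancelʳ-≡ _ _ (g ℕ.^ N) (begin
      (x ℕ.^ N ℕ.+ y ℕ.^ N) ℕ.* g ℕ.^ N
        ≡⟨ ℕ.*-distribʳ-+ (g ℕ.^ N) (x ℕ.^ N) (y ℕ.^ N) ⟩
      x ℕ.^ N ℕ.* g ℕ.^ N ℕ.+ y ℕ.^ N ℕ.* g ℕ.^ N
        ≡⟨ cong₂ ℕ._+_ (power-distrib x N) (power-distrib y N) ⟨
      (x ℕ.* g) ℕ.^ N ℕ.+ (y ℕ.* g) ℕ.^ N
        ≡⟨ cong₂ (λ u v → u ℕ.^ N ℕ.+ v ℕ.^ N) b≡xg c≡yg ⟩
      b ℕ.^ N ℕ.+ c ℕ.^ N
        ≡⟨ root ⟩
      b ℕ.* c ℕ.* q b c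
        ≡⟨ cong₂ (λ u v → u ℕ.* v ℕ.* q u v) b≡xg c≡yg ⟨
      x ℕ.* g ℕ.* (y ℕ.* g) ℕ.* q (x ℕ.* g) (y ℕ.* g)
        ≡⟨ cong (x ℕ.* g ℕ.* (y ℕ.* g) ℕ.*_) (q-homogeneous x y g) ⟩
      x ℕ.* g ℕ.* (y ℕ.* g) ℕ.* (q x y ℕ.* g ℕ.^ n)
        ≡⟨ collect x y g (q x y) (g ℕ.^ n) ⟩
      x ℕ.* y ℕ.* q x y ℕ.* g ℕ.^ N ∎)
      where open ≡.≡-Reasoning

    x⊥y : Coprime x y
    x⊥y = coprime-/gcd b c

    x≡1 : x ≡ 1
    x≡1 = coprime-root≡1 x y x⊥y reduced

    y≡1 : y ≡ 1
    y≡1 = coprime-power-divisor N (Coprimality.sym x⊥y)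
      (∣m+n∣m⇒∣n {m = y ℕ.^ N}
        (subst (y ∣_) (≡.sym (≡.trans (ℕ.+-comm (y ℕ.^ N) (x ℕ.^ N)) reduced))
          (∣-trans (n∣m*n x) (m∣m*n (q x y))))
        (m∣m*n _))

-- With t = c/b this is 1 + t^3 = 2t^2, that is (t - 1)(t^2 - t - 1) = 0; the conclusion is the root
-- t = 1.
golden-root⇒≡ : ∀ b c .{{_ : ℕ.NonZero b}} →
  b ℕ.^ 3 ℕ.+ c ℕ.^ 3 ≡ b ℕ.* c ℕ.* (c ℕ.+ c) → b ≡ c
golden-root⇒≡ = root⇒≡ {1} {λ b c → c ℕ.+ c} homogeneous
  where
  homogeneous : ∀ x y g → y ℕ.* g ℕ.+ y ℕ.* g ≡ (y ℕ.+ y) ℕ.* (g ℕ.* 1)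
  homogeneous = solve-∀

-- With t = c/b this is (t - 1)(t^3 - t - 1) = 0.
plastic-root⇒≡ : ∀ b c .{{_ : ℕ.NonZero b}} →
  b ℕ.^ 4 ℕ.+ c ℕ.^ 4 ≡ b ℕ.* c ℕ.* (c ℕ.* (b ℕ.+ c)) → b ≡ c
plastic-root⇒≡ = root⇒≡ {2} {λ b c → c ℕ.* (b ℕ.+ c)} homogeneous
  where
  homogeneous : ∀ x y g →
    y ℕ.* g ℕ.* (x ℕ.* g ℕ.+ y ℕ.* g) ≡ y ℕ.* (x ℕ.+ y) ℕ.* (g ℕ.* (g ℕ.* 1))
  homogeneous = solve-∀

-- With t = c/b this is (t - 1)(t^3 - t^2 - t - 1) = 0.
tribonacci-root⇒≡ : ∀ b c .{{_ : ℕ.NonZero b}} →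
  b ℕ.^ 4 ℕ.+ c ℕ.^ 4 ≡ b ℕ.* c ℕ.* (c ℕ.* (c ℕ.+ c)) → b ≡ c
tribonacci-root⇒≡ = root⇒≡ {2} {λ b c → c ℕ.* (c ℕ.+ c)} homogeneous
  where
  homogeneous : ∀ x y g →
    y ℕ.* g ℕ.* (y ℕ.* g ℕ.+ y ℕ.* g) ≡ y ℕ.* (y ℕ.+ y) ℕ.* (g ℕ.* (g ℕ.* 1))
  homogeneous = solve-∀

-- The product equations give b^3 = abc = a^2 d, so the left side is a^2 (a + d) = 2a^2 c = 2ab^2.
golden-progression-root : ∀ a b c d → a ℕ.* c ≡ b ℕ.* b → a ℕ.* d ≡ b ℕ.* c → a ℕ.+ d ≡ c ℕ.+ c →
  a ℕ.^ 3 ℕ.+ b ℕ.^ 3 ≡ a ℕ.* b ℕ.* (b ℕ.+ b)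
golden-progression-root a b c d ac≡bb ad≡bc a+d≡c+c = begin
  a ℕ.^ 3 ℕ.+ b ℕ.^ 3                          ≡⟨ cubes a b ⟩
  a ℕ.* (a ℕ.* a) ℕ.+ b ℕ.* (b ℕ.* b)          ≡⟨ cong (λ t → a ℕ.* (a ℕ.* a) ℕ.+ b ℕ.* t) ac≡bb ⟨
  a ℕ.* (a ℕ.* a) ℕ.+ b ℕ.* (a ℕ.* c)          ≡⟨ cong (a ℕ.* (a ℕ.* a) ℕ.+_) (swap a b c) ⟩
  a ℕ.* (a ℕ.* a) ℕ.+ a ℕ.* (b ℕ.* c)          ≡⟨ cong (λ t → a ℕ.* (a ℕ.* a) ℕ.+ a ℕ.* t) ad≡bc ⟨
  a ℕ.* (a ℕ.* a) ℕ.+ a ℕ.* (a ℕ.* d)          ≡⟨ factor a d ⟩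
  a ℕ.* (a ℕ.* (a ℕ.+ d))                      ≡⟨ cong (λ t → a ℕ.* (a ℕ.* t)) a+d≡c+c ⟩
  a ℕ.* (a ℕ.* (c ℕ.+ c))                      ≡⟨ double a c ⟩
  a ℕ.* (a ℕ.* c ℕ.+ a ℕ.* c)                  ≡⟨ cong (λ t → a ℕ.* (t ℕ.+ t)) ac≡bb ⟩
  a ℕ.* (b ℕ.* b ℕ.+ b ℕ.* b)                  ≡⟨ collect a b ⟩
  a ℕ.* b ℕ.* (b ℕ.+ b)                        ∎
  where
  open ≡.≡-Reasoning
  cubes : ∀ a b → a ℕ.* (a ℕ.* (a ℕ.* 1)) ℕ.+ b ℕ.* (b ℕ.* (b ℕ.* 1))
    ≡ a ℕ.* (a ℕ.* a) ℕ.+ b ℕ.* (b ℕ.* b)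
  cubes = solve-∀
  swap : ∀ a b c → b ℕ.* (a ℕ.* c) ≡ a ℕ.* (b ℕ.* c)
  swap = solve-∀
  factor : ∀ a d → a ℕ.* (a ℕ.* a) ℕ.+ a ℕ.* (a ℕ.* d) ≡ a ℕ.* (a ℕ.* (a ℕ.+ d))
  factor = solve-∀
  double : ∀ a c → a ℕ.* (a ℕ.* (c ℕ.+ c)) ≡ a ℕ.* (a ℕ.* c ℕ.+ a ℕ.* c)
  double = solve-∀
  collect : ∀ a b → a ℕ.* (b ℕ.* b ℕ.+ b ℕ.* b) ≡ a ℕ.* b ℕ.* (b ℕ.+ b)
  collect = solve-∀

module _ (a b c d : ℕ) (bd≡cc : b ℕ.* d ≡ c ℕ.* c) (ad≡bb : a ℕ.* d ≡ b ℕ.* b) where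

  private
    -- Evaluating abd in two ways eliminates d.
    acc≡bbb : a ℕ.* (c ℕ.* c) ≡ b ℕ.* (b ℕ.* b)
    acc≡bbb = begin
      a ℕ.* (c ℕ.* c)  ≡⟨ cong (a ℕ.*_) bd≡cc ⟨
      a ℕ.* (b ℕ.* d)  ≡⟨ swap a b d ⟩
      b ℕ.* (a ℕ.* d)  ≡⟨ cong (b ℕ.*_) ad≡bb ⟩
      b ℕ.* (b ℕ.* b)  ∎
      where
      open ≡.≡-Reasoning
      swap : ∀ a b d → a ℕ.* (b ℕ.* d) ≡ b ℕ.* (a ℕ.* d)
      swap = solve-∀

  -- Replacing b^3 by ac^2 leaves (a + c)c^2 = 2bc^2.
  golden-root : a ℕ.+ c ≡ b ℕ.+ b → b ℕ.^ 3 ℕ.+ c ℕ.^ 3 ≡ b ℕ.* c ℕ.* (c ℕ.+ c)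
  golden-root a+c≡b+b = begin
    b ℕ.^ 3 ℕ.+ c ℕ.^ 3                    ≡⟨ cubes b c ⟩
    b ℕ.* (b ℕ.* b) ℕ.+ c ℕ.* (c ℕ.* c)    ≡⟨ cong (ℕ._+ c ℕ.* (c ℕ.* c)) acc≡bbb ⟨
    a ℕ.* (c ℕ.* c) ℕ.+ c ℕ.* (c ℕ.* c)    ≡⟨ ℕ.*-distribʳ-+ (c ℕ.* c) a c ⟨
    (a ℕ.+ c) ℕ.* (c ℕ.* c)                ≡⟨ cong (ℕ._* (c ℕ.* c)) a+c≡b+b ⟩
    (b ℕ.+ b) ℕ.* (c ℕ.* c)                ≡⟨ collect b c ⟩
    b ℕ.* c ℕ.* (c ℕ.+ c)                  ∎
    where
    open ≡.≡-Reasoning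
    cubes : ∀ b c → b ℕ.* (b ℕ.* (b ℕ.* 1)) ℕ.+ c ℕ.* (c ℕ.* (c ℕ.* 1))
      ≡ b ℕ.* (b ℕ.* b) ℕ.+ c ℕ.* (c ℕ.* c)
    cubes = solve-∀
    collect : ∀ b c → (b ℕ.+ b) ℕ.* (c ℕ.* c) ≡ b ℕ.* c ℕ.* (c ℕ.+ c)
    collect = solve-∀

  -- Here b^4 = abc^2 and c^4 = bc^2 d, so the left side is bc^2 (a + d). Leaving `e` free serves
  -- both b + c and c + c.
  quartic-root : ∀ e → a ℕ.+ d ≡ e → b ℕ.^ 4 ℕ.+ c ℕ.^ 4 ≡ b ℕ.* c ℕ.* (c ℕ.* e)
  quartic-root e a+d≡e = begin
    b ℕ.^ 4 ℕ.+ c ℕ.^ 4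
      ≡⟨ fourth-powers b c ⟩
    b ℕ.* (b ℕ.* (b ℕ.* b)) ℕ.+ c ℕ.* c ℕ.* (c ℕ.* c)
      ≡⟨ cong₂ (λ t u → b ℕ.* t ℕ.+ c ℕ.* c ℕ.* u) acc≡bbb bd≡cc ⟨
    b ℕ.* (a ℕ.* (c ℕ.* c)) ℕ.+ c ℕ.* c ℕ.* (b ℕ.* d)
      ≡⟨ factor a b c d ⟩
    b ℕ.* c ℕ.* (c ℕ.* (a ℕ.+ d))
      ≡⟨ cong (λ t → b ℕ.* c ℕ.* (c ℕ.* t)) a+d≡e ⟩
    b ℕ.* c ℕ.* (c ℕ.* e) ∎
    where
    open ≡.≡-Reasoning
    fourth-powers : ∀ b c → b ℕ.* (b ℕ.* (b ℕ.* (b ℕ.* 1))) ℕ.+ c ℕ.* (c ℕ.* (c ℕ.* (c ℕ.* 1)))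
      ≡ b ℕ.* (b ℕ.* (b ℕ.* b)) ℕ.+ c ℕ.* c ℕ.* (c ℕ.* c)
    fourth-powers = solve-∀
    factor : ∀ a b c d → b ℕ.* (a ℕ.* (c ℕ.* c)) ℕ.+ c ℕ.* c ℕ.* (b ℕ.* d)
      ≡ b ℕ.* c ℕ.* (c ℕ.* (a ℕ.+ d))
    factor = solve-∀

-- Sums versus products in an ordered ring

record OrderedRing : Set₁ where
  field
    commutativeRing : CommutativeRing 0ℓ 0ℓ

  open CommutativeRing commutativeRing public

  field
    Positive        : Pred Carrier 0ℓ
    Positive-resp-≈ : ∀ {x y} → x ≈ y → Positive x → Positive y
    Positive-+      : ∀ {x y} → Positive x → Positive y → Positive (x + y)
    Positive-*      : ∀ {x y} → Positive x → Positive y → Positive (x * y)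
    0-notPositive   : ¬ Positive 0#
    -- The form of trichotomy that holds constructively for Cauchy reals, whose sign cannot be
    -- decided.
    ¬±Positive⇒≈0   : ∀ x → ¬ Positive x → ¬ Positive (- x) → x ≈ 0#

module SumProduct (𝓡 : OrderedRing) where

  open OrderedRing 𝓡 renaming (refl to ≈-refl; sym to ≈-sym; trans to ≈-trans)
  open AbelianGroupProperties +-abelianGroup
    renaming (∙-cancelˡ to +-cancelˡ) using (⁻¹-anti-homo-//; xyx⁻¹≈y; x∙y⁻¹≈ε⇒x≈y)
  open SemiringSolver commutativeSemiring using (solve; _:=_; _:+_; _:*_)
  open Cardinality setoid

  infix 4 _<_

  -- The difference is part of the data, so larger elements can be rewritten as sums and products
  -- compared by a semiring solver, free of subtraction.
  _<_ : Carrier → Carrier → Set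
  x < y = ∃[ δ ] (Positive δ × y ≈ x + δ)

  x+[y-x]≈y : ∀ x y → x + (y - x) ≈ y
  x+[y-x]≈y x y = ≈-trans (≈-sym (+-assoc x y (- x))) (xyx⁻¹≈y x y)

  <-connex : ∀ {x y} → ¬ x < y → ¬ y < x → x ≈ y
  <-connex {x} {y} x≮y y≮x = ≈-sym (x∙y⁻¹≈ε⇒x≈y y x (¬±Positive⇒≈0 (y - x)
    (λ 0<y-x → x≮y (y - x , 0<y-x , ≈-sym (x+[y-x]≈y x y)))
    (λ 0<-[y-x] → y≮x (x - y , Positive-resp-≈ (⁻¹-anti-homo-// y x) 0<-[y-x]
      , ≈-sym (x+[y-x]≈y y x)))))

  <-isStrictPartialOrder : IsStrictPartialOrder _≈_ _<_
  <-isStrictPartialOrder = record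
    { isEquivalence = isEquivalence
    ; irrefl = λ { {x} x≈y (δ , 0<δ , y≈x+δ) → 0-notPositive (Positive-resp-≈
        (+-cancelˡ x _ _ (≈-trans (≈-sym y≈x+δ) (≈-trans (≈-sym x≈y) (≈-sym (+-identityʳ x))))) 0<δ) }
    ; trans = λ { {x} (δ , 0<δ , y≈x+δ) (ε , 0<ε , z≈y+ε) →
        δ + ε , Positive-+ 0<δ 0<ε , ≈-trans z≈y+ε (≈-trans (+-congʳ y≈x+δ) (+-assoc x δ ε)) }
    ; <-resp-≈ =
        (λ { y≈z (δ , 0<δ , y≈x+δ) → δ , 0<δ , ≈-trans (≈-sym y≈z) y≈x+δ })
      , (λ { y≈z (δ , 0<δ , x≈y+δ) → δ , 0<δ , ≈-trans x≈y+δ (+-congʳ y≈z) })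
    }

  open IsStrictPartialOrder <-isStrictPartialOrder using (<-respʳ-≈; <-respˡ-≈; asym)
    renaming (trans to <-trans; irrefl to <⇒≉)
  open Sorting <-isStrictPartialOrder <-connex

  additive : OrderedSemigroup
  additive = record
    { commutativeSemigroup = +-commutativeSemigroup
    ; <-isStrictPartialOrder = <-isStrictPartialOrder
    ; <-connex = <-connex
    ; Positive = Positive
    ; Positive-∙ = Positive-+
    ; ∙-monoʳ-< = λ { {z} {x} _ (δ , 0<δ , y≈x+δ) →
        δ , 0<δ , ≈-trans (+-congˡ y≈x+δ) (≈-sym (+-assoc z x δ)) }
    }

  multiplicative : OrderedSemigroup
  multiplicative = record
    { commutativeSemigroup = *-commutativeSemigroup
    ; <-isStrictPartialOrder = <-isStrictPartialOrder
    ; <-connex = <-connex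
    ; Positive = Positive
    ; Positive-∙ = Positive-*
    ; ∙-monoʳ-< = λ { {z} {x} 0<z (δ , 0<δ , y≈x+δ) →
        z * δ , Positive-* 0<z 0<δ , ≈-trans (*-congˡ y≈x+δ) (distribˡ z x δ) }
    }

  module Sums = Coincidences additive
  module Products = Coincidences multiplicative

  -- With z = x + δ and y = z + η the hypothesis gives w = x + η, and then
  -- z w = x y + δ η.
  equal-sums⇒outer-product< : ∀ {x y z w} → x < z → z < y → x + y ≈ z + w → x * y < z * w
  equal-sums⇒outer-product< {x} {y} {z} {w} (δ , 0<δ , z≈x+δ) (η , 0<η , y≈z+η) x+y≈z+w =
    δ * η , Positive-* 0<δ 0<η , (begin
      z * w                        ≈⟨ *-cong z≈x+δ w≈x+η ⟩
      (x + δ) * (x + η)            ≈⟨ solve 3 (λ x δ η →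
                                        (x :+ δ) :* (x :+ η) := x :* ((x :+ δ) :+ η) :+ δ :* η)
                                        ≈-refl x δ η ⟩
      x * ((x + δ) + η) + δ * η    ≈⟨ +-congʳ (*-congˡ (≈-trans y≈z+η (+-congʳ z≈x+δ))) ⟨
      x * y + δ * η                ∎)
    where
    open ≈-Reasoning setoid
    w≈x+η : w ≈ x + η
    w≈x+η = +-cancelˡ z w (x + η) (begin
      z + w        ≈⟨ x+y≈z+w ⟨
      x + y        ≈⟨ +-congˡ y≈z+η ⟩
      x + (z + η)  ≈⟨ solve 3 (λ x z η → x :+ (z :+ η) := z :+ (x :+ η)) ≈-refl x z η ⟩
      z + (x + η)  ∎)

  -- The sum coincidences force (a, b, c, d) = (a, a + δ, a + 2δ, a + 4δ),
  -- for which b d = c c + a δ.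
  a+c≈b+b∧a+d≈c+c⇒cc<bd : ∀ {a b c d} → Positive a → a < b →
    a + c ≈ b + b → a + d ≈ c + c → c * c < b * d
  a+c≈b+b∧a+d≈c+c⇒cc<bd {a} {b} {c} {d} 0<a (δ , 0<δ , b≈a+δ) a+c≈b+b a+d≈c+c =
    a * δ , Positive-* 0<a 0<δ , (begin
      b * d                                       ≈⟨ *-cong b≈a+δ d≈ ⟩
      (a + δ) * (a + ((δ + δ) + (δ + δ)))         ≈⟨ solve 2 (λ a δ →
          (a :+ δ) :* (a :+ ((δ :+ δ) :+ (δ :+ δ)))
            := (a :+ (δ :+ δ)) :* (a :+ (δ :+ δ)) :+ a :* δ) ≈-refl a δ ⟩
      (a + (δ + δ)) * (a + (δ + δ)) + a * δ       ≈⟨ +-congʳ (*-cong c≈ c≈) ⟨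
      c * c + a * δ                               ∎)
    where
    open ≈-Reasoning setoid
    c≈ : c ≈ a + (δ + δ)
    c≈ = +-cancelˡ a c _ (begin
      a + c              ≈⟨ a+c≈b+b ⟩
      b + b              ≈⟨ +-cong b≈a+δ b≈a+δ ⟩
      (a + δ) + (a + δ)  ≈⟨ solve 2 (λ a δ → (a :+ δ) :+ (a :+ δ) := a :+ (a :+ (δ :+ δ))) ≈-refl a δ ⟩
      a + (a + (δ + δ))  ∎)
    d≈ : d ≈ a + ((δ + δ) + (δ + δ))
    d≈ = +-cancelˡ a d _ (begin
      a + d                            ≈⟨ a+d≈c+c ⟩
      c + c                            ≈⟨ +-cong c≈ c≈ ⟩
      (a + (δ + δ)) + (a + (δ + δ))    ≈⟨ solve 2 (λ a δ →
          (a :+ (δ :+ δ)) :+ (a :+ (δ :+ δ)) := a :+ (a :+ ((δ :+ δ) :+ (δ :+ δ)))) ≈-refl a δ ⟩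
      a + (a + ((δ + δ) + (δ + δ)))    ∎)

  -- In terms of r = b/a for the first case and r = c/b for the others, removing the root 1 leaves
  -- r^2 = r + 1 twice, r^3 = r + 1 and r^3 = r^2 + r + 1.
  data Exceptional (a b c d : Carrier) : Set where
    golden-progression : a * c ≈ b * b → a * d ≈ b * c → a + d ≈ c + c → Exceptional a b c d
    golden             : b * d ≈ c * c → a * d ≈ b * b → a + c ≈ b + b → Exceptional a b c d
    plastic            : b * d ≈ c * c → a * d ≈ b * b → a + d ≈ b + c → Exceptional a b c d
    tribonacci         : b * d ≈ c * c → a * d ≈ b * b → a + d ≈ c + c → Exceptional a b c d

  module _ {a b c d} (0<a : Positive a) (0<b : Positive b) (0<c : Positive c) (0<d : Positive d)
    (a<b : a < b) (b<c : b < c) (c<d : c < d) where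

    private
      a+c≈b+b⇒ac<bb : a + c ≈ b + b → a * c < b * b
      a+c≈b+b⇒ac<bb = equal-sums⇒outer-product< a<b b<c

      b+d≈c+c⇒bd<cc : b + d ≈ c + c → b * d < c * c
      b+d≈c+c⇒bd<cc = equal-sums⇒outer-product< b<c c<d

      a+d≈b+c⇒ad<bc : a + d ≈ b + c → a * d < b * c
      a+d≈b+c⇒ad<bc = equal-sums⇒outer-product< a<b (<-trans b<c c<d)

      a+d≈b+b⇒ad<bb : a + d ≈ b + b → a * d < b * b
      a+d≈b+b⇒ad<bb = equal-sums⇒outer-product< a<b (<-trans b<c c<d)

      a+d≈c+c⇒ad<cc : a + d ≈ c + c → a * d < c * c
      a+d≈c+c⇒ad<cc = equal-sums⇒outer-product< (<-trans a<b b<c) c<d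

      *-monoˡ-< : ∀ {x y z} → Positive z → x < y → x * z < y * z
      *-monoˡ-< = Products.∙-monoˡ-<

      *-monoʳ-< : ∀ {x y z} → Positive z → x < y → z * x < z * y
      *-monoʳ-< = OrderedSemigroup.∙-monoʳ-< multiplicative

      bb<bc : b * b < b * c
      bb<bc = *-monoʳ-< 0<b b<c

      bc<cc : b * c < c * c
      bc<cc = *-monoˡ-< 0<c b<c

      ad<bd : a * d < b * d
      ad<bd = *-monoˡ-< 0<d a<b

    -- A coincidence of sums puts the outer product strictly below the inner one. Together with bb <
    -- bc < cc and ad < bd this refutes eleven of the fifteen combinations.
    doubleProduct∧sum⇒exceptional :
      Products.DoubleCoincidence a b c d → Sums.Coincidence a b c d → Exceptional a b c d
    doubleProduct∧sum⇒exceptional (Products.progression ac≈bb bd≈cc ad≈bc) = λ where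
      (Sums.⟨ac≈bb⟩ e) → contradiction (a+c≈b+b⇒ac<bb e) (<⇒≉ ac≈bb)
      (Sums.⟨bd≈cc⟩ e) → contradiction (b+d≈c+c⇒bd<cc e) (<⇒≉ bd≈cc)
      (Sums.⟨ad≈bc⟩ e) → contradiction (a+d≈b+c⇒ad<bc e) (<⇒≉ ad≈bc)
      (Sums.⟨ad≈bb⟩ e) → contradiction (<-trans (a+d≈b+b⇒ad<bb e) bb<bc) (<⇒≉ ad≈bc)
      (Sums.⟨ad≈cc⟩ e) → golden-progression ac≈bb ad≈bc e
    doubleProduct∧sum⇒exceptional (Products.⟨ac≈bb,ad≈cc⟩ ac≈bb ad≈cc) = λ where
      (Sums.⟨ac≈bb⟩ e) → contradiction (a+c≈b+b⇒ac<bb e) (<⇒≉ ac≈bb)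
      (Sums.⟨bd≈cc⟩ e) → contradiction (<-respˡ-≈ ad≈cc ad<bd) (asym (b+d≈c+c⇒bd<cc e))
      (Sums.⟨ad≈bc⟩ e) → contradiction (<-trans (a+d≈b+c⇒ad<bc e) bc<cc) (<⇒≉ ad≈cc)
      (Sums.⟨ad≈bb⟩ e) → contradiction (<-trans (a+d≈b+b⇒ad<bb e) (<-trans bb<bc bc<cc)) (<⇒≉ ad≈cc)
      (Sums.⟨ad≈cc⟩ e) → contradiction (a+d≈c+c⇒ad<cc e) (<⇒≉ ad≈cc)
    doubleProduct∧sum⇒exceptional (Products.⟨bd≈cc,ad≈bb⟩ bd≈cc ad≈bb) = λ where
      (Sums.⟨ac≈bb⟩ e) → golden bd≈cc ad≈bb e
      (Sums.⟨bd≈cc⟩ e) → contradiction (b+d≈c+c⇒bd<cc e) (<⇒≉ bd≈cc)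
      (Sums.⟨ad≈bc⟩ e) → plastic bd≈cc ad≈bb e
      (Sums.⟨ad≈bb⟩ e) → contradiction (a+d≈b+b⇒ad<bb e) (<⇒≉ ad≈bb)
      (Sums.⟨ad≈cc⟩ e) → tribonacci bd≈cc ad≈bb e

    -- In eight of the nine combinations a single sum equation is already impossible. The ninth
    -- would be `golden` and `tribonacci` at once, where the explicit form of the set gives cc < bd.
    ¬doubleProduct∧doubleSum :
      Products.DoubleCoincidence a b c d → ¬ Sums.DoubleCoincidence a b c d
    ¬doubleProduct∧doubleSum (Products.progression ac≈bb bd≈cc ad≈bc) = λ where
      (Sums.progression e _ _)     → <⇒≉ ac≈bb (a+c≈b+b⇒ac<bb e)
      (Sums.⟨ac≈bb,ad≈cc⟩ e _)     → <⇒≉ ac≈bb (a+c≈b+b⇒ac<bb e)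
      (Sums.⟨bd≈cc,ad≈bb⟩ e _)     → <⇒≉ bd≈cc (b+d≈c+c⇒bd<cc e)
    ¬doubleProduct∧doubleSum (Products.⟨ac≈bb,ad≈cc⟩ ac≈bb ad≈cc) = λ where
      (Sums.progression e _ _)     → <⇒≉ ac≈bb (a+c≈b+b⇒ac<bb e)
      (Sums.⟨ac≈bb,ad≈cc⟩ e _)     → <⇒≉ ac≈bb (a+c≈b+b⇒ac<bb e)
      (Sums.⟨bd≈cc,ad≈bb⟩ e _)     → asym (b+d≈c+c⇒bd<cc e) (<-respˡ-≈ ad≈cc ad<bd)
    ¬doubleProduct∧doubleSum (Products.⟨bd≈cc,ad≈bb⟩ bd≈cc ad≈bb) = λ where
      (Sums.progression _ e _)     → <⇒≉ bd≈cc (b+d≈c+c⇒bd<cc e)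
      (Sums.⟨ac≈bb,ad≈cc⟩ e f)     → <⇒≉ (≈-sym bd≈cc) (a+c≈b+b∧a+d≈c+c⇒cc<bd 0<a a<b e f)
      (Sums.⟨bd≈cc,ad≈bb⟩ e _)     → <⇒≉ bd≈cc (b+d≈c+c⇒bd<cc e)

  -- Sizes of the sumset and the productset of at most four elements

  module _ {A : Pred Carrier 0ℓ} (A⊆Positive : A ⊆ Positive) where

    private
      members : ∀ {xs} → xs Lists A → All A xs
      members lists = All.tabulate λ x∈xs → Equivalence.from (lists _) (Any.map reflexive x∈xs)

    module _ {s p} (sumSize : Size (Pairwise _+_ A) s) (productSize : Size (Pairwise _*_ A) p) where

      size₁-sum-product : Size A 1 → (1 ≡ s) × (1 ≡ p)
      size₁-sum-product size with Size⇒Lists size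
      ... | a ∷ [] , refl , _ , lists with a∈A ∷ [] ← members lists =
          ℕ.≤-antisym (distinct⇒length≤ sumSize (Sums.product∈ A⊆Positive sumSize a∈A a∈A ∷ []) ([] ∷ []))
            (Pairwise-size≤ +-cong +-comm lists sumSize)
        , ℕ.≤-antisym
            (distinct⇒length≤ productSize (Products.product∈ A⊆Positive productSize a∈A a∈A ∷ []) ([] ∷ []))
            (Pairwise-size≤ *-cong *-comm lists productSize)

      size₂-sum-product : Size A 2 → (3 ≡ s) × (3 ≡ p)
      size₂-sum-product size = decidable-stable ((3 ℕ.≟ s) ×-dec (3 ℕ.≟ p)) λ k →
        Size⇒sorted size λ where
          (a ∷ b ∷ [] , refl , (a<b ∷ []) ∷ _ , lists) → pair k a<b lists (members lists)
        where
        pair : ∀ {a b} → ¬ ((3 ≡ s) × (3 ≡ p)) → a < b → (a ∷ b ∷ []) Lists A →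
          ¬ All A (a ∷ b ∷ [])
        pair k a<b lists (a∈A ∷ b∈A ∷ []) = k
          ( ℕ.≤-antisym (Sums.size₂ A⊆Positive sumSize a∈A b∈A a<b)
              (Pairwise-size≤ +-cong +-comm lists sumSize)
          , ℕ.≤-antisym (Products.size₂ A⊆Positive productSize a∈A b∈A a<b)
              (Pairwise-size≤ *-cong *-comm lists productSize))

      -- Five sums force a + c = 2b and five products force ac = bb, but the former implies ac < bb.
      size₃-sum-product : Size A 3 → (5 ≤ s × s ≤ 6) × (5 ≤ p × p ≤ 6) × ¬ (s ≤ 5 × p ≤ 5)
      size₃-sum-product size = decidable-stable
        (((5 ℕ.≤? s) ×-dec (s ℕ.≤? 6)) ×-dec ((5 ℕ.≤? p) ×-dec (p ℕ.≤? 6))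
          ×-dec ¬? ((s ℕ.≤? 5) ×-dec (p ℕ.≤? 5))) λ k →
        Size⇒sorted size λ where
          (a ∷ b ∷ c ∷ [] , refl , (a<b ∷ _) ∷ (b<c ∷ []) ∷ _ , lists) →
            triple k a<b b<c lists (members lists)
        where
        triple : ∀ {a b c} → ¬ ((5 ≤ s × s ≤ 6) × (5 ≤ p × p ≤ 6) × ¬ (s ≤ 5 × p ≤ 5)) →
          a < b → b < c → (a ∷ b ∷ c ∷ []) Lists A → ¬ All A (a ∷ b ∷ c ∷ [])
        triple k a<b b<c lists (a∈A ∷ b∈A ∷ c∈A ∷ []) = k
          ( (S.size₃ , Pairwise-size≤ +-cong +-comm lists sumSize)
          , (P.size₃ , Pairwise-size≤ *-cong *-comm lists productSize)
          , λ (s≤5 , p≤5) → <⇒≉ (P.m≤5⇒ac≈bb p≤5)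
              (equal-sums⇒outer-product< a<b b<c (S.m≤5⇒ac≈bb s≤5)))
          where
          module S = Sums.Triple A⊆Positive sumSize a∈A b∈A c∈A a<b b<c
          module P = Products.Triple A⊆Positive productSize a∈A b∈A c∈A a<b b<c

      -- For the last component: at most eight products and at most eight sums would be double
      -- coincidences on both sides.
      size₄-sum-product : Size A 4 → (7 ≤ s × s ≤ 10) × (7 ≤ p × p ≤ 10) × (p ≤ 8 → 9 ≤ s)
      size₄-sum-product size = decidable-stable
        (((7 ℕ.≤? s) ×-dec (s ℕ.≤? 10)) ×-dec ((7 ℕ.≤? p) ×-dec (p ℕ.≤? 10))
          ×-dec ((p ℕ.≤? 8) →-dec (9 ℕ.≤? s))) λ k →
        Size⇒sorted size λ where
          (a ∷ b ∷ c ∷ d ∷ [] , refl , (a<b ∷ _) ∷ (b<c ∷ _) ∷ (c<d ∷ []) ∷ _ , lists) →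
            quadruple k a<b b<c c<d lists (members lists)
        where
        quadruple : ∀ {a b c d} → ¬ ((7 ≤ s × s ≤ 10) × (7 ≤ p × p ≤ 10) × (p ≤ 8 → 9 ≤ s)) →
          a < b → b < c → c < d → (a ∷ b ∷ c ∷ d ∷ []) Lists A → ¬ All A (a ∷ b ∷ c ∷ d ∷ [])
        quadruple k a<b b<c c<d lists (a∈A ∷ b∈A ∷ c∈A ∷ d∈A ∷ []) = k
          ( (S.size₄ , Pairwise-size≤ +-cong +-comm lists sumSize)
          , (P.size₄ , Pairwise-size≤ *-cong *-comm lists productSize)
          , λ p≤8 → ℕ.≰⇒> λ s≤8 → ¬doubleProduct∧doubleSum
              (A⊆Positive a∈A) (A⊆Positive b∈A) (A⊆Positive c∈A) (A⊆Positive d∈A) a<b b<c c<d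
              (P.m≤8⇒doubleCoincidence p≤8) (S.m≤8⇒doubleCoincidence s≤8))
          where
          module S = Sums.Quadruple A⊆Positive sumSize a∈A b∈A c∈A d∈A a<b b<c c<d
          module P = Products.Quadruple A⊆Positive productSize a∈A b∈A c∈A d∈A a<b b<c c<d

      -- The inequalities in the premise matter: four equal elements satisfy every equation of
      -- `Exceptional`.
      size₄-few-products : Size A 4 →
        (∀ {a b c d} → a ∈ A → b ∈ A → c ∈ A → d ∈ A → a < b → b < c → ¬ Exceptional a b c d) →
        p ≤ 8 → 10 ≤ s
      size₄-few-products size unexceptional p≤8 = decidable-stable (10 ℕ.≤? s) λ k →
        Size⇒sorted size λ where
          (a ∷ b ∷ c ∷ d ∷ [] , refl , (a<b ∷ _) ∷ (b<c ∷ _) ∷ (c<d ∷ []) ∷ _ , lists) →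
            quadruple (ℕ.≤-pred (ℕ.≰⇒> k)) a<b b<c c<d (members lists)
        where
        quadruple : ∀ {a b c d} → s ≤ 9 → a < b → b < c → c < d → ¬ All A (a ∷ b ∷ c ∷ d ∷ [])
        quadruple s≤9 a<b b<c c<d (a∈A ∷ b∈A ∷ c∈A ∷ d∈A ∷ []) = unexceptional a∈A b∈A c∈A d∈A a<b b<c
          (doubleProduct∧sum⇒exceptional
            (A⊆Positive a∈A) (A⊆Positive b∈A) (A⊆Positive c∈A) (A⊆Positive d∈A) a<b b<c c<d
            (P.m≤8⇒doubleCoincidence p≤8) (S.m≤9⇒coincidence s≤9))
          where
          module S = Sums.Quadruple A⊆Positive sumSize a∈A b∈A c∈A d∈A a<b b<c c<d
          module P = Products.Quadruple A⊆Positive productSize a∈A b∈A c∈A d∈A a<b b<c c<d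

  -- Natural numbers and their extension by the golden ratio

  module NaturalNumbers (ι : ℕ → Carrier)
    (ι-injective : ∀ {m n} → ι m ≈ ι n → m ≡ n)
    (ι-+ : ∀ m n → ι (m ℕ.+ n) ≈ ι m + ι n)
    (ι-* : ∀ m n → ι (m ℕ.* n) ≈ ι m * ι n) where

    private
      sums : ∀ {x y z w k l m n} → x ≈ ι k → y ≈ ι l → z ≈ ι m → w ≈ ι n →
        x + y ≈ z + w → k ℕ.+ l ≡ m ℕ.+ n
      sums {k = k} {l} {m} {n} x≈ y≈ z≈ w≈ e = ι-injective (≈-trans (ι-+ k l)
        (≈-trans (+-cong (≈-sym x≈) (≈-sym y≈)) (≈-trans e (≈-trans (+-cong z≈ w≈) (≈-sym (ι-+ m n))))))

      products : ∀ {x y z w k l m n} → x ≈ ι k → y ≈ ι l → z ≈ ι m → w ≈ ι n →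
        x * y ≈ z * w → k ℕ.* l ≡ m ℕ.* n
      products {k = k} {l} {m} {n} x≈ y≈ z≈ w≈ e = ι-injective (≈-trans (ι-* k l)
        (≈-trans (*-cong (≈-sym x≈) (≈-sym y≈)) (≈-trans e (≈-trans (*-cong z≈ w≈) (≈-sym (ι-* m n))))))

    -- Injectivity of `ι` pulls the equations back to natural numbers, where the root lemmas force
    -- the ratio 1, against a < b or b < c.
    unexceptional : ∀ {a b c d} k l m n .{{_ : ℕ.NonZero k}} .{{_ : ℕ.NonZero l}} →
      a ≈ ι k → b ≈ ι l → c ≈ ι m → d ≈ ι n → a < b → b < c → ¬ Exceptional a b c d
    unexceptional k l m n a≈ b≈ c≈ d≈ a<b b<c (golden-progression ac≈bb ad≈bc a+d≈c+c) =
      <⇒≉ (≈-trans a≈ (≈-trans (reflexive (cong ι k≡l)) (≈-sym b≈))) a<b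
      where
      k≡l : k ≡ l
      k≡l = golden-root⇒≡ k l
        (golden-progression-root k l m n
          (products a≈ c≈ b≈ b≈ ac≈bb) (products a≈ d≈ b≈ c≈ ad≈bc) (sums a≈ d≈ c≈ c≈ a+d≈c+c))
    unexceptional k l m n a≈ b≈ c≈ d≈ a<b b<c (golden bd≈cc ad≈bb a+c≈b+b) =
      <⇒≉ (≈-trans b≈ (≈-trans (reflexive (cong ι l≡m)) (≈-sym c≈))) b<c
      where
      l≡m : l ≡ m
      l≡m = golden-root⇒≡ l m (golden-root k l m n
        (products b≈ d≈ c≈ c≈ bd≈cc) (products a≈ d≈ b≈ b≈ ad≈bb) (sums a≈ c≈ b≈ b≈ a+c≈b+b))
    unexceptional k l m n a≈ b≈ c≈ d≈ a<b b<c (plastic bd≈cc ad≈bb a+d≈b+c) =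
      <⇒≉ (≈-trans b≈ (≈-trans (reflexive (cong ι l≡m)) (≈-sym c≈))) b<c
      where
      l≡m : l ≡ m
      l≡m = plastic-root⇒≡ l m (quartic-root k l m n
        (products b≈ d≈ c≈ c≈ bd≈cc) (products a≈ d≈ b≈ b≈ ad≈bb) (l ℕ.+ m) (sums a≈ d≈ b≈ c≈ a+d≈b+c))
    unexceptional k l m n a≈ b≈ c≈ d≈ a<b b<c (tribonacci bd≈cc ad≈bb a+d≈c+c) =
      <⇒≉ (≈-trans b≈ (≈-trans (reflexive (cong ι l≡m)) (≈-sym c≈))) b<c
      where
      l≡m : l ≡ m
      l≡m = tribonacci-root⇒≡ l m (quartic-root k l m n
        (products b≈ d≈ c≈ c≈ bd≈cc) (products a≈ d≈ b≈ b≈ ad≈bb) (m ℕ.+ m) (sums a≈ d≈ c≈ c≈ a+d≈c+c))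

    -- ℤ[φ] with φ the golden ratio, restricted to nonnegative coefficients:
    -- (m , n) stands for m + n φ.
    module GoldenIntegers (ι-positive : ∀ {n} → 0 ℕ.< n → Positive (ι n))
      {φ : Carrier} (0<φ : Positive φ) (φφ≈φ+1 : φ * φ ≈ φ + 1#) where

      open ≈-Reasoning setoid

      ⟦_⟧ : ℕ × ℕ → Carrier
      ⟦ m , n ⟧ = ι m + ι n * φ

      -- The two summands ln in a product come from lnφ² = lnφ + ln.
      _⊕_ _⊗_ : ℕ × ℕ → ℕ × ℕ → ℕ × ℕ
      (k , l) ⊕ (m , n) = k ℕ.+ m , l ℕ.+ n
      (k , l) ⊗ (m , n) = k ℕ.* m ℕ.+ l ℕ.* n , k ℕ.* n ℕ.+ l ℕ.* m ℕ.+ l ℕ.* n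

      ι-0 : ι 0 ≈ 0#
      ι-0 = +-cancelˡ (ι 0) (ι 0) 0# (≈-trans (≈-sym (ι-+ 0 0)) (≈-sym (+-identityʳ (ι 0))))

      ⟦⟧-⊕ : ∀ x y → ⟦ x ⊕ y ⟧ ≈ ⟦ x ⟧ + ⟦ y ⟧
      ⟦⟧-⊕ (k , l) (m , n) = begin
        ι (k ℕ.+ m) + ι (l ℕ.+ n) * φ        ≈⟨ +-cong (ι-+ k m) (*-congʳ (ι-+ l n)) ⟩
        (ι k + ι m) + (ι l + ι n) * φ        ≈⟨ solve 5 (λ k l m n φ →
            (k :+ m) :+ (l :+ n) :* φ := (k :+ l :* φ) :+ (m :+ n :* φ))
            ≈-refl (ι k) (ι l) (ι m) (ι n) φ ⟩
        (ι k + ι l * φ) + (ι m + ι n * φ)    ∎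

      ⟦⟧-⊗ : ∀ x y → ⟦ x ⊗ y ⟧ ≈ ⟦ x ⟧ * ⟦ y ⟧
      ⟦⟧-⊗ (k , l) (m , n) = begin
        ι (k ℕ.* m ℕ.+ l ℕ.* n) + ι (k ℕ.* n ℕ.+ l ℕ.* m ℕ.+ l ℕ.* n) * φ
          ≈⟨ +-cong
               (≈-trans (ι-+ (k ℕ.* m) (l ℕ.* n)) (+-cong (ι-* k m) (ι-* l n)))
               (*-congʳ (≈-trans (ι-+ (k ℕ.* n ℕ.+ l ℕ.* m) (l ℕ.* n))
                 (+-cong (≈-trans (ι-+ (k ℕ.* n) (l ℕ.* m)) (+-cong (ι-* k n) (ι-* l m))) (ι-* l n)))) ⟩
        (K * M + L * N) + (K * N + L * M + L * N) * φ
          ≈⟨ solve 5 (λ K L M N φ →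
               (K :* M :+ L :* N) :+ (K :* N :+ L :* M :+ L :* N) :* φ
                 := K :* M :+ (K :* N :+ L :* M) :* φ :+ (L :* N :* φ :+ L :* N))
               ≈-refl K L M N φ ⟩
        K * M + (K * N + L * M) * φ + (L * N * φ + L * N)
          ≈⟨ +-congˡ (+-congˡ (*-identityʳ (L * N))) ⟨
        K * M + (K * N + L * M) * φ + (L * N * φ + L * N * 1#)
          ≈⟨ +-congˡ (≈-trans (*-congˡ φφ≈φ+1) (distribˡ (L * N) φ 1#)) ⟨
        K * M + (K * N + L * M) * φ + L * N * (φ * φ)
          ≈⟨ solve 5 (λ K L M N φ →
               K :* M :+ (K :* N :+ L :* M) :* φ :+ L :* N :* (φ :* φ)
                 := (K :+ L :* φ) :* (M :+ N :* φ))
               ≈-refl K L M N φ ⟩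
        (K + L * φ) * (M + N * φ) ∎
        where
        K = ι k
        L = ι l
        M = ι m
        N = ι n

      ⟦⟧-positive : ∀ m n → 0 ℕ.< m ℕ.+ n → Positive ⟦ m , n ⟧
      ⟦⟧-positive zero    n       0<n = Positive-resp-≈
        (≈-sym (≈-trans (+-congʳ ι-0) (+-identityˡ _))) (Positive-* (ι-positive 0<n) 0<φ)
      ⟦⟧-positive (suc m) zero    _   = Positive-resp-≈
        (≈-sym (≈-trans (+-congˡ (≈-trans (*-congʳ ι-0) (zeroˡ φ))) (+-identityʳ _)))
        (ι-positive (s≤s z≤n))
      ⟦⟧-positive (suc m) (suc n) _   =
        Positive-+ (ι-positive (s≤s z≤n)) (Positive-* (ι-positive (s≤s z≤n)) 0<φ)

      -- Squaring j = kφ gives j² = kj + k², which implies the cubic k³ + j³ = 2kj². Hence k = j,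
      -- and the quadratic then reads k² = 2k².
      φ-irrational : ∀ j k → 0 ℕ.< k → ¬ ι j ≈ ι k * φ
      φ-irrational j k 0<k ιj≈ιkφ = ℕ.<⇒≢ 0<k (≡.sym k≡0)
        where
        instance
          k-nonZero : ℕ.NonZero k
          k-nonZero = ℕ.>-nonZero 0<k

        jj≡kj+kk : j ℕ.* j ≡ k ℕ.* j ℕ.+ k ℕ.* k
        jj≡kj+kk = ι-injective (begin
          ι (j ℕ.* j)                        ≈⟨ ι-* j j ⟩
          ι j * ι j                          ≈⟨ *-cong ιj≈ιkφ ιj≈ιkφ ⟩
          (ι k * φ) * (ι k * φ)              ≈⟨ solve 2 (λ k φ →
              (k :* φ) :* (k :* φ) := k :* k :* (φ :* φ)) ≈-refl (ι k) φ ⟩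
          ι k * ι k * (φ * φ)                ≈⟨ *-congˡ φφ≈φ+1 ⟩
          ι k * ι k * (φ + 1#)               ≈⟨ distribˡ (ι k * ι k) φ 1# ⟩
          ι k * ι k * φ + ι k * ι k * 1#     ≈⟨ +-cong (*-assoc (ι k) (ι k) φ) (*-identityʳ _) ⟩
          ι k * (ι k * φ) + ι k * ι k        ≈⟨ +-congʳ (*-congˡ ιj≈ιkφ) ⟨
          ι k * ι j + ι k * ι k              ≈⟨ +-cong (ι-* k j) (ι-* k k) ⟨
          ι (k ℕ.* j) + ι (k ℕ.* k)          ≈⟨ ι-+ (k ℕ.* j) (k ℕ.* k) ⟨
          ι (k ℕ.* j ℕ.+ k ℕ.* k)            ∎)

        k≡j : k ≡ j
        k≡j = golden-root⇒≡ k j (cubic j k jj≡kj+kk)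
          where
          cubic : ∀ j k → j ℕ.* j ≡ k ℕ.* j ℕ.+ k ℕ.* k →
            k ℕ.^ 3 ℕ.+ j ℕ.^ 3 ≡ k ℕ.* j ℕ.* (j ℕ.+ j)
          cubic j k jj≡ = ≡.trans (expand j k) (≡.trans
            (cong (λ t → k ℕ.* (k ℕ.* k) ℕ.+ j ℕ.* t) jj≡) (≡.trans (regroup j k)
            (≡.trans (cong (λ t → k ℕ.* (j ℕ.* j) ℕ.+ k ℕ.* t) (≡.sym jj≡)) (collect j k))))
            where
            expand : ∀ j k → k ℕ.* (k ℕ.* (k ℕ.* 1)) ℕ.+ j ℕ.* (j ℕ.* (j ℕ.* 1))
              ≡ k ℕ.* (k ℕ.* k) ℕ.+ j ℕ.* (j ℕ.* j)
            expand = solve-∀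
            regroup : ∀ j k → k ℕ.* (k ℕ.* k) ℕ.+ j ℕ.* (k ℕ.* j ℕ.+ k ℕ.* k)
              ≡ k ℕ.* (j ℕ.* j) ℕ.+ k ℕ.* (k ℕ.* j ℕ.+ k ℕ.* k)
            regroup = solve-∀
            collect : ∀ j k → k ℕ.* (j ℕ.* j) ℕ.+ k ℕ.* (j ℕ.* j) ≡ k ℕ.* j ℕ.* (j ℕ.+ j)
            collect = solve-∀

        k≡0 : k ≡ 0
        k≡0 = ℕ.m*n≡0⇒m≡0 k k
          (ℕ.+-cancelˡ-≡ (k ℕ.* k) (k ℕ.* k) 0 (≡.trans
            (≡.sym (subst (λ j → j ℕ.* j ≡ k ℕ.* j ℕ.+ k ℕ.* k) (≡.sym k≡j) jj≡kj+kk))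
            (≡.sym (ℕ.+-identityʳ (k ℕ.* k)))))

      -- For m ≤ n the right side is strictly larger; for m > n the difference m - n would equal kφ.
      ι≉ι+kφ : ∀ m n k → 0 ℕ.< k → ¬ ι m ≈ ι n + ι k * φ
      ι≉ι+kφ m n k 0<k ιm≈ with ℕ.<-cmp m n
      ... | tri< m<n _ _ = <⇒≉ ιm≈ (ι (n ℕ.∸ m) + ι k * φ
          , Positive-+ (ι-positive (ℕ.m<n⇒0<n∸m m<n)) (Positive-* (ι-positive 0<k) 0<φ)
          , (begin
              ι n + ι k * φ                        ≡⟨ cong (λ t → ι t + ι k * φ) (ℕ.m+[n∸m]≡n (ℕ.<⇒≤ m<n)) ⟨
              ι (m ℕ.+ (n ℕ.∸ m)) + ι k * φ        ≈⟨ +-congʳ (ι-+ m (n ℕ.∸ m)) ⟩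
              (ι m + ι (n ℕ.∸ m)) + ι k * φ        ≈⟨ +-assoc (ι m) (ι (n ℕ.∸ m)) (ι k * φ) ⟩
              ι m + (ι (n ℕ.∸ m) + ι k * φ)        ∎))
      ... | tri≈ _ refl _ = <⇒≉ ιm≈ (ι k * φ , Positive-* (ι-positive 0<k) 0<φ , ≈-refl)
      ... | tri> _ _ n<m = φ-irrational (m ℕ.∸ n) k 0<k (+-cancelˡ (ι n) _ _ (begin
          ι n + ι (m ℕ.∸ n)        ≈⟨ ι-+ n (m ℕ.∸ n) ⟨
          ι (n ℕ.+ (m ℕ.∸ n))      ≡⟨ cong ι (ℕ.m+[n∸m]≡n (ℕ.<⇒≤ n<m)) ⟩
          ι m                      ≈⟨ ιm≈ ⟩
          ι n + ι k * φ            ∎))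

      ⟦⟧≉⟦⟧ : ∀ {k l m n} → l ℕ.< n → ¬ ⟦ k , l ⟧ ≈ ⟦ m , n ⟧
      ⟦⟧≉⟦⟧ {k} {l} {m} {n} l<n eq = ι≉ι+kφ k m (n ℕ.∸ l) (ℕ.m<n⇒0<n∸m l<n)
        (+-cancelˡ (ι l * φ) _ _ (begin
          ι l * φ + ι k                              ≈⟨ +-comm (ι l * φ) (ι k) ⟩
          ι k + ι l * φ                              ≈⟨ eq ⟩
          ι m + ι n * φ                              ≡⟨ cong (λ t → ι m + ι t * φ) (ℕ.m+[n∸m]≡n (ℕ.<⇒≤ l<n)) ⟨
          ι m + ι (l ℕ.+ (n ℕ.∸ l)) * φ              ≈⟨ +-congˡ (*-congʳ (ι-+ l (n ℕ.∸ l))) ⟩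
          ι m + (ι l + ι (n ℕ.∸ l)) * φ              ≈⟨ solve 4 (λ l m d φ →
              m :+ (l :+ d) :* φ := l :* φ :+ (m :+ d :* φ)) ≈-refl (ι l) (ι m) (ι (n ℕ.∸ l)) φ ⟩
          ι l * φ + (ι m + ι (n ℕ.∸ l) * φ)          ∎))

      ⟦⟧-injective : ∀ {x y} → ⟦ x ⟧ ≈ ⟦ y ⟧ → x ≡ y
      ⟦⟧-injective {k , l} {m , n} eq with ℕ.<-cmp l n
      ... | tri< l<n _ _  = contradiction eq (⟦⟧≉⟦⟧ l<n)
      ... | tri> _ _ n<l  = contradiction (≈-sym eq) (⟦⟧≉⟦⟧ n<l)
      ... | tri≈ _ refl _ = cong (_, l) (ι-injective (+-cancelˡ (ι l * φ) _ _
          (≈-trans (+-comm (ι l * φ) (ι k)) (≈-trans eq (+-comm (ι m) (ι l * φ))))))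

open import Defs

-- The ordered commutative ring of Cauchy reals

private
  open ℚ-Solver.+-*-Solver

  shift : ∀ p q → p ≡ q ℚ.+ (p ℚ.- q)
  shift = solve 2 (λ p q → p := q :+ (p :- q)) refl

  rest : ∀ p q → p ℚ.- (p ℚ.- q) ≡ q
  rest = solve 2 (λ p q → p :- (p :- q) := q) refl

  halve : ∀ p → ½ ℚ.* p ≡ p ℚ.- ½ ℚ.* p
  halve = solve 1 (λ p → con ½ :* p := p :- con ½ :* p) refl

  swap-difference : ∀ p q → ℚ.- (p ℚ.- q) ≡ q ℚ.- p
  swap-difference = solve 2 (λ p q → :- (p :- q) := q :- p) refl

  join-differences : ∀ p q r → (p ℚ.- q) ℚ.+ (q ℚ.- r) ≡ p ℚ.- r
  join-differences = solve 3 (λ p q r → (p :- q) :+ (q :- r) := p :- r) refl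

  sum-difference : ∀ p q r s → (p ℚ.- q) ℚ.+ (r ℚ.- s) ≡ (p ℚ.+ r) ℚ.- (q ℚ.+ s)
  sum-difference = solve 4 (λ p q r s → (p :- q) :+ (r :- s) := (p :+ r) :- (q :+ s)) refl

  product-difference : ∀ p q r s →
    p ℚ.* (r ℚ.- s) ℚ.+ s ℚ.* (p ℚ.- q) ≡ p ℚ.* r ℚ.- q ℚ.* s
  product-difference =
    solve 4 (λ p q r s → p :* (r :- s) :+ s :* (p :- q) := p :* r :- q :* s) refl

-- Null sequences

Eventually : (ℕ → Set) → Set
Eventually P = ∃[ N ] (∀ n → N ≤ n → P n)

eventually-zipWith : ∀ {P Q R : ℕ → Set} → (∀ n → P n → Q n → R n) →
  Eventually P → Eventually Q → Eventually R
eventually-zipWith f (M , p) (N , q) = M ℕ.⊔ N , λ n h →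
  f n (p n (ℕ.m⊔n≤o⇒m≤o M N h)) (q n (ℕ.m⊔n≤o⇒n≤o M N h))

eventually-map : ∀ {P Q : ℕ → Set} → (∀ n → P n → Q n) → Eventually P → Eventually Q
eventually-map f (N , p) = N , λ n h → f n (p n h)

eventually-const : ∀ {A : Set} → Eventually (λ _ → A) → A
eventually-const (N , a) = a N ℕ.≤-refl

-- `x ≈ y` unfolds to `IsNull` of the termwise difference, so its laws become closure properties of
-- null sequences.
IsNull : (ℕ → ℚ) → Set
IsNull u = ∀ ε → 0ℚ ℚ.< ε → Eventually (λ n → ∣ u n ∣ ℚ.< ε)

0<½* : ∀ {ε} → 0ℚ ℚ.< ε → 0ℚ ℚ.< ½ ℚ.* ε
0<½* {ε} 0<ε = ℚ.positive⁻¹ (½ ℚ.* ε) {{ℚ.pos*pos⇒pos ½ ε {{ℚ.positive 0<ε}}}}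

½*+½* : ∀ ε → ½ ℚ.* ε ℚ.+ ½ ℚ.* ε ≡ ε
½*+½* ε = ≡.trans (≡.sym (ℚ.*-distribʳ-+ ε ½ ½)) (ℚ.*-identityˡ ε)

p≤∣p∣ : ∀ p → p ℚ.≤ ∣ p ∣
p≤∣p∣ p with ℚ.≤-total 0ℚ p
... | inj₁ 0≤p = ℚ.≤-reflexive (≡.sym (ℚ.0≤p⇒∣p∣≡p 0≤p))
... | inj₂ p≤0 = ℚ.≤-trans p≤0 (ℚ.0≤∣p∣ p)

IsNull-cong : ∀ {u v} → (∀ n → u n ≡ v n) → IsNull u → IsNull v
IsNull-cong u≡v u→0 ε 0<ε =
  eventually-map (λ n → subst (λ t → ∣ t ∣ ℚ.< ε) (u≡v n)) (u→0 ε 0<ε)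

IsNull-0 : IsNull (λ _ → 0ℚ)
IsNull-0 ε 0<ε = 0 , λ _ _ → 0<ε

IsNull-neg : ∀ {u} → IsNull u → IsNull (λ n → ℚ.- u n)
IsNull-neg {u} u→0 ε 0<ε =
  eventually-map (λ n → subst (ℚ._< ε) (≡.sym (ℚ.∣-p∣≡∣p∣ (u n)))) (u→0 ε 0<ε)

IsNull-+ : ∀ {u v} → IsNull u → IsNull v → IsNull (λ n → u n ℚ.+ v n)
IsNull-+ {u} {v} u→0 v→0 ε 0<ε =
  eventually-zipWith
    (λ n p q → subst (∣ u n ℚ.+ v n ∣ ℚ.<_) (½*+½* ε)
      (ℚ.≤-<-trans (ℚ.∣p+q∣≤∣p∣+∣q∣ (u n) (v n)) (ℚ.+-mono-< p q)))
    (u→0 (½ ℚ.* ε) (0<½* 0<ε)) (v→0 (½ ℚ.* ε) (0<½* 0<ε))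

cauchy⇒bounded : ∀ x → IsCauchy x →
  Σ[ B ∈ ℚ ] (0ℚ ℚ.< B × Eventually (λ n → ∣ x n ∣ ℚ.< B))
cauchy⇒bounded x cx = let N , close = cx 1ℚ (ℚ.positive⁻¹ 1ℚ) in
  ∣ x N ∣ ℚ.+ 1ℚ
  , ℚ.+-mono-≤-< (ℚ.0≤∣p∣ (x N)) (ℚ.positive⁻¹ 1ℚ)
  , N
  , λ n N≤n → let open ℚ.≤-Reasoning in begin-strict
      ∣ x n ∣                      ≡⟨ cong ∣_∣ (shift (x n) (x N)) ⟩
      ∣ x N ℚ.+ (x n ℚ.- x N) ∣    ≤⟨ ℚ.∣p+q∣≤∣p∣+∣q∣ (x N) (x n ℚ.- x N) ⟩
      ∣ x N ∣ ℚ.+ ∣ x n ℚ.- x N ∣  <⟨ ℚ.+-monoʳ-< ∣ x N ∣ (close n N N≤n ℕ.≤-refl) ⟩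
      ∣ x N ∣ ℚ.+ 1ℚ               ∎

positive-quotient : ∀ {B ε} → 0ℚ ℚ.< B → 0ℚ ℚ.< ε → Σ[ δ ∈ ℚ ] (0ℚ ℚ.< δ × B ℚ.* δ ≡ ε)
positive-quotient {B} {ε} 0<B 0<ε =
  1/ B ℚ.* ε
  , ℚ.positive⁻¹ (1/ B ℚ.* ε) {{ℚ.pos*pos⇒pos (1/ B) {{ℚ.1/pos⇒pos B}} ε {{ℚ.positive 0<ε}}}}
  , ≡.trans (≡.sym (ℚ.*-assoc B (1/ B) ε))
      (≡.trans (cong (ℚ._* ε) (ℚ.*-inverseʳ B)) (ℚ.*-identityˡ ε))
  where
  instance
    B-pos : ℚ.Positive B
    B-pos = ℚ.positive 0<B
    B-nonZero : ℚ.NonZero B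
    B-nonZero = ℚ.pos⇒nonZero B

∣p*q∣<B*δ : ∀ {B δ} p q → 0ℚ ℚ.< B → ∣ p ∣ ℚ.< B → ∣ q ∣ ℚ.< δ → ∣ p ℚ.* q ∣ ℚ.< B ℚ.* δ
∣p*q∣<B*δ {B} {δ} p q 0<B p<B q<δ = let open ℚ.≤-Reasoning in begin-strict
  ∣ p ℚ.* q ∣      ≡⟨ ℚ.∣p*q∣≡∣p∣*∣q∣ p q ⟩
  ∣ p ∣ ℚ.* ∣ q ∣  ≤⟨ ℚ.*-monoʳ-≤-nonNeg ∣ q ∣ {{ℚ.∣-∣-nonNeg q}} (ℚ.<⇒≤ p<B) ⟩
  B ℚ.* ∣ q ∣      <⟨ ℚ.*-monoʳ-<-pos B {{ℚ.positive 0<B}} q<δ ⟩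
  B ℚ.* δ          ∎

IsNull-* : ∀ {x u} → IsCauchy x → IsNull u → IsNull (λ n → x n ℚ.* u n)
IsNull-* {x} {u} cx u→0 ε 0<ε =
  let B , 0<B , x<B    = cauchy⇒bounded x cx
      δ , 0<δ , Bδ≡ε = positive-quotient 0<B 0<ε
  in eventually-zipWith
       (λ n p q → subst (∣ x n ℚ.* u n ∣ ℚ.<_) Bδ≡ε (∣p*q∣<B*δ (x n) (u n) 0<B p q))
       x<B (u→0 δ 0<δ)

pointwise : ∀ {x y} → (∀ n → seq x n ≡ seq y n) → x ≈ y
pointwise {x} {y} x≡y = IsNull-cong
  (λ n → ≡.trans (≡.sym (ℚ.+-inverseʳ (seq y n))) (cong (ℚ._- seq y n) (≡.sym (x≡y n))))
  IsNull-0

≈-isEquivalence : IsEquivalence _≈_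
≈-isEquivalence = record
  { refl  = λ {x} → pointwise {x} {x} (λ _ → refl)
  ; sym   = λ {x} {y} x≈y → IsNull-cong (λ n → swap-difference (seq x n) (seq y n))
      (IsNull-neg {λ n → seq x n ℚ.- seq y n} x≈y)
  ; trans = λ {x} {y} {z} x≈y y≈z →
      IsNull-cong (λ n → join-differences (seq x n) (seq y n) (seq z n))
        (IsNull-+ {λ n → seq x n ℚ.- seq y n} {λ n → seq y n ℚ.- seq z n} x≈y y≈z)
  }

0ℝ 1ℝ : ℝ
0ℝ = fromℚ 0ℚ
1ℝ = fromℚ 1ℚ

infix 8 -_

-- Negation as multiplication by -1 inherits its Cauchy proof and its congruence from `_*_`.
-_ : ℝ → ℝ
- x = fromℚ (ℚ.- 1ℚ) * x

+-cong : ∀ {x y u v} → x ≈ y → u ≈ v → x + u ≈ y + v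
+-cong {x} {y} {u} {v} x≈y u≈v =
  IsNull-cong (λ n → sum-difference (seq x n) (seq y n) (seq u n) (seq v n))
    (IsNull-+ {λ n → seq x n ℚ.- seq y n} {λ n → seq u n ℚ.- seq v n} x≈y u≈v)

*-cong : ∀ {x y u v} → x ≈ y → u ≈ v → x * u ≈ y * v
*-cong {x} {y} {u} {v} x≈y u≈v =
  IsNull-cong (λ n → product-difference (seq x n) (seq y n) (seq u n) (seq v n))
    (IsNull-+ {λ n → seq x n ℚ.* (seq u n ℚ.- seq v n)}
              {λ n → seq v n ℚ.* (seq x n ℚ.- seq y n)}
      (IsNull-* {seq x} {λ n → seq u n ℚ.- seq v n} (cauchy x) u≈v)
      (IsNull-* {seq v} {λ n → seq x n ℚ.- seq y n} (cauchy v) x≈y))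

ℝ-isCommutativeRing : IsCommutativeRing _≈_ _+_ _*_ -_ 0ℝ 1ℝ
ℝ-isCommutativeRing = record
  { isRing = record
    { +-isAbelianGroup = record
      { isGroup = record
        { isMonoid = record
          { isSemigroup = record
            { isMagma = record
              { isEquivalence = ≈-isEquivalence
              ; ∙-cong = λ {x} {y} {u} {v} → +-cong {x} {y} {u} {v} }
            ; assoc = λ x y z → pointwise {(x + y) + z} {x + (y + z)}
                (λ n → ℚ.+-assoc (seq x n) (seq y n) (seq z n)) }
          ; identity =
              (λ x → pointwise {0ℝ + x} {x} (λ n → ℚ.+-identityˡ (seq x n)))
            , (λ x → pointwise {x + 0ℝ} {x} (λ n → ℚ.+-identityʳ (seq x n))) }
        ; inverse =
            (λ x → pointwise { - x + x} {0ℝ} (λ n → inverseˡ (seq x n)))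
          , (λ x → pointwise {x + - x} {0ℝ} (λ n → inverseʳ (seq x n)))
        ; ⁻¹-cong = λ {x} {y} →
            *-cong {fromℚ (ℚ.- 1ℚ)} {fromℚ (ℚ.- 1ℚ)} {x} {y} (λ _ 0<ε → 0 , λ _ _ → 0<ε) }
      ; comm = λ x y → pointwise {x + y} {y + x} (λ n → ℚ.+-comm (seq x n) (seq y n)) }
    ; *-cong = λ {x} {y} {u} {v} → *-cong {x} {y} {u} {v}
    ; *-assoc = λ x y z → pointwise {(x * y) * z} {x * (y * z)}
        (λ n → ℚ.*-assoc (seq x n) (seq y n) (seq z n))
    ; *-identity =
        (λ x → pointwise {1ℝ * x} {x} (λ n → ℚ.*-identityˡ (seq x n)))
      , (λ x → pointwise {x * 1ℝ} {x} (λ n → ℚ.*-identityʳ (seq x n)))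
    ; distrib =
        (λ x y z → pointwise {x * (y + z)} {x * y + x * z}
          (λ n → ℚ.*-distribˡ-+ (seq x n) (seq y n) (seq z n)))
      , (λ x y z → pointwise {(y + z) * x} {y * x + z * x}
          (λ n → ℚ.*-distribʳ-+ (seq x n) (seq y n) (seq z n))) }
  ; *-comm = λ x y → pointwise {x * y} {y * x} (λ n → ℚ.*-comm (seq x n) (seq y n)) }
  where
  inverseˡ : ∀ p → (ℚ.- 1ℚ) ℚ.* p ℚ.+ p ≡ 0ℚ
  inverseˡ = solve 1 (λ p → (:- con 1ℚ) :* p :+ p := con 0ℚ) refl
  inverseʳ : ∀ p → p ℚ.+ (ℚ.- 1ℚ) ℚ.* p ≡ 0ℚ
  inverseʳ = solve 1 (λ p → p :+ (:- con 1ℚ) :* p := con 0ℚ) refl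

ℝ-commutativeRing : CommutativeRing 0ℓ 0ℓ
ℝ-commutativeRing = record { isCommutativeRing = ℝ-isCommutativeRing }

ℝ₊-resp-≈ : ∀ {x y} → x ≈ y → ℝ₊ x → ℝ₊ y
ℝ₊-resp-≈ {x} {y} x≈y (ε , 0<ε , ε<x) =
  ½ ℚ.* ε , 0<½* 0<ε ,
  eventually-zipWith (λ n → above (seq x n) (seq y n)) ε<x (x≈y (½ ℚ.* ε) (0<½* 0<ε))
  where
  above : ∀ p q → ε ℚ.< p → ∣ p ℚ.- q ∣ ℚ.< ½ ℚ.* ε → ½ ℚ.* ε ℚ.< q
  above p q ε<p close = let open ℚ.≤-Reasoning in begin-strict
    ½ ℚ.* ε              ≡⟨ halve ε ⟩
    ε ℚ.- ½ ℚ.* ε        <⟨ ℚ.+-mono-< ε<p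
                              (ℚ.neg-antimono-< (ℚ.≤-<-trans (p≤∣p∣ (p ℚ.- q)) close)) ⟩
    p ℚ.- (p ℚ.- q)      ≡⟨ rest p q ⟩
    q                    ∎

ℝ₊-+ : ∀ {x y} → ℝ₊ x → ℝ₊ y → ℝ₊ (x + y)
ℝ₊-+ (ε , 0<ε , ε<x) (δ , 0<δ , δ<y) =
  ε ℚ.+ δ , ℚ.+-mono-< 0<ε 0<δ , eventually-zipWith (λ _ → ℚ.+-mono-<) ε<x δ<y

ℝ₊-* : ∀ {x y} → ℝ₊ x → ℝ₊ y → ℝ₊ (x * y)
ℝ₊-* {x} {y} (ε , 0<ε , ε<x) (δ , 0<δ , δ<y) =
  ε ℚ.* δ , ℚ.positive⁻¹ (ε ℚ.* δ) {{ℚ.pos*pos⇒pos ε {{ℚ.positive 0<ε}} δ {{ℚ.positive 0<δ}}}} ,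
  eventually-zipWith (λ n ε<xₙ δ<yₙ → ℚ.<-trans
      (ℚ.*-monoˡ-<-pos δ {{ℚ.positive 0<δ}} ε<xₙ)
      (ℚ.*-monoʳ-<-pos (seq x n) {{ℚ.positive (ℚ.<-trans 0<ε ε<xₙ)}} δ<yₙ))
    ε<x δ<y

0∉ℝ₊ : ¬ ℝ₊ 0ℝ
0∉ℝ₊ (ε , 0<ε , ε<0) = ℚ.<-asym 0<ε (eventually-const ε<0)

-- Beyond `N` the terms differ by less than ε/4. The rational |z_N| can be compared with ε/2: below
-- it, the tail stays within ε of 0; otherwise z or -z eventually exceeds ε/4.
¬ℝ₊⇒≈0 : ∀ z → ¬ ℝ₊ z → ¬ ℝ₊ (- z) → z ≈ 0ℝ
¬ℝ₊⇒≈0 z z≯0 -z≯0 ε 0<ε with cauchy z (½ ℚ.* (½ ℚ.* ε)) (0<½* (0<½* 0<ε))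
... | N , close with ∣ seq z N ∣ ℚ.<? ½ ℚ.* ε
...   | yes small = N , λ n N≤n → subst (λ t → ∣ t ∣ ℚ.< ε) (≡.sym (ℚ.+-identityʳ (seq z n)))
          (near n (close n N N≤n ℕ.≤-refl))
  where
  ½ε<ε : ½ ℚ.* (½ ℚ.* ε) ℚ.< ½ ℚ.* ε
  ½ε<ε = subst (½ ℚ.* (½ ℚ.* ε) ℚ.<_) (½*+½* (½ ℚ.* ε))
    (subst (ℚ._< ½ ℚ.* (½ ℚ.* ε) ℚ.+ ½ ℚ.* (½ ℚ.* ε)) (ℚ.+-identityʳ _)
      (ℚ.+-monoʳ-< (½ ℚ.* (½ ℚ.* ε)) (0<½* (0<½* 0<ε))))
  near : ∀ n → ∣ seq z n ℚ.- seq z N ∣ ℚ.< ½ ℚ.* (½ ℚ.* ε) → ∣ seq z n ∣ ℚ.< ε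
  near n d = let open ℚ.≤-Reasoning in begin-strict
    ∣ seq z n ∣                              ≡⟨ cong ∣_∣ (shift (seq z n) (seq z N)) ⟩
    ∣ seq z N ℚ.+ (seq z n ℚ.- seq z N) ∣    ≤⟨ ℚ.∣p+q∣≤∣p∣+∣q∣ (seq z N) (seq z n ℚ.- seq z N) ⟩
    ∣ seq z N ∣ ℚ.+ ∣ seq z n ℚ.- seq z N ∣  <⟨ ℚ.+-mono-< small (ℚ.<-trans d ½ε<ε) ⟩
    ½ ℚ.* ε ℚ.+ ½ ℚ.* ε                      ≡⟨ ½*+½* ε ⟩
    ε                                        ∎
...   | no large = contradiction (ℚ.∣p∣≡p∨∣p∣≡-p (seq z N)) [ positive , negative ]′
  where
  δ : ℚ
  δ = ½ ℚ.* (½ ℚ.* ε)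
  0<δ : 0ℚ ℚ.< δ
  0<δ = 0<½* (0<½* 0<ε)
  negated-rest : ∀ p q → ℚ.- p ℚ.- (q ℚ.- p) ≡ (ℚ.- 1ℚ) ℚ.* q
  negated-rest = solve 2 (λ p q → :- p :- (q :- p) := (:- con 1ℚ) :* q) refl
  positive : ¬ (∣ seq z N ∣ ≡ seq z N)
  positive eq = z≯0 (δ , 0<δ , N , λ n N≤n → let open ℚ.≤-Reasoning in begin-strict
    δ                                          ≡⟨ halve (½ ℚ.* ε) ⟩
    ½ ℚ.* ε ℚ.- δ                              <⟨ ℚ.+-mono-≤-< (subst (½ ℚ.* ε ℚ.≤_) eq (ℚ.≮⇒≥ large))
        (ℚ.neg-antimono-< (ℚ.≤-<-trans (p≤∣p∣ _) (close N n ℕ.≤-refl N≤n))) ⟩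
    seq z N ℚ.- (seq z N ℚ.- seq z n)          ≡⟨ rest (seq z N) (seq z n) ⟩
    seq z n                                    ∎)
  negative : ¬ (∣ seq z N ∣ ≡ ℚ.- seq z N)
  negative eq = -z≯0 (δ , 0<δ , N , λ n N≤n → let open ℚ.≤-Reasoning in begin-strict
    δ                                          ≡⟨ halve (½ ℚ.* ε) ⟩
    ½ ℚ.* ε ℚ.- δ                              <⟨ ℚ.+-mono-≤-< (subst (½ ℚ.* ε ℚ.≤_) eq (ℚ.≮⇒≥ large))
        (ℚ.neg-antimono-< (ℚ.≤-<-trans (p≤∣p∣ _) (close n N N≤n ℕ.≤-refl))) ⟩
    ℚ.- seq z N ℚ.- (seq z n ℚ.- seq z N)      ≡⟨ negated-rest (seq z N) (seq z n) ⟩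
    (ℚ.- 1ℚ) ℚ.* seq z n                       ∎)

-- Natural numbers and the golden ratio as Cauchy reals

ℝ-orderedRing : OrderedRing
ℝ-orderedRing = record
  { commutativeRing = ℝ-commutativeRing
  ; Positive        = ℝ₊
  ; Positive-resp-≈ = λ {x} {y} → ℝ₊-resp-≈ {x} {y}
  ; Positive-+      = λ {x} {y} → ℝ₊-+ {x} {y}
  ; Positive-*      = λ {x} {y} → ℝ₊-* {x} {y}
  ; 0-notPositive   = 0∉ℝ₊
  ; ¬±Positive⇒≈0   = ¬ℝ₊⇒≈0
  }

private
  module R = OrderedRing ℝ-orderedRing

-- Normalisation by the gcd is stuck on a variable `n`, so the normal form has to be supplied as an
-- equation.
n/1≡mkℚ : ∀ n → ℤ.+ n ℚ./ 1 ≡ ℚ.mkℚ (ℤ.+ n) 0 (Coprimality.sym (Coprimality.1-coprimeTo n))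
n/1≡mkℚ n = ℚ.normalize-coprime (Coprimality.sym (Coprimality.1-coprimeTo n))

/1-+ : ∀ m n → ℤ.+ (m ℕ.+ n) ℚ./ 1 ≡ ℤ.+ m ℚ./ 1 ℚ.+ ℤ.+ n ℚ./ 1
/1-+ m n = ≡.trans
  (cong (ℚ._/ 1) (≡.sym (cong₂ ℤ._+_ (ℤ.*-identityʳ (ℤ.+ m)) (ℤ.*-identityʳ (ℤ.+ n)))))
  (≡.sym (cong₂ ℚ._+_ (n/1≡mkℚ m) (n/1≡mkℚ n)))

/1-* : ∀ m n → ℤ.+ (m ℕ.* n) ℚ./ 1 ≡ ℤ.+ m ℚ./ 1 ℚ.* (ℤ.+ n ℚ./ 1)
/1-* m n = ≡.trans (cong (ℚ._/ 1) (ℤ.pos-* m n))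
  (≡.sym (cong₂ ℚ._*_ (n/1≡mkℚ m) (n/1≡mkℚ n)))

/1-injective : ∀ {m n} → ℤ.+ m ℚ./ 1 ≡ ℤ.+ n ℚ./ 1 → m ≡ n
/1-injective {m} {n} eq =
  ℤ.+-injective (cong ℚ.↥_ (≡.trans (≡.sym (n/1≡mkℚ m)) (≡.trans eq (n/1≡mkℚ n))))

fromℚ-injective : ∀ {p q} → fromℚ p ≈ fromℚ q → p ≡ q
fromℚ-injective {p} {q} p≈q with p ℚ.≟ q
... | yes p≡q = p≡q
-- Taking ε = |p - q| yields |p - q| < |p - q|.
... | no  p≢q = contradiction (eventually-const (p≈q ∣ p ℚ.- q ∣ 0<∣p-q∣)) (ℚ.<-irrefl refl)
  where
  open AbelianGroupProperties ℚ.+-0-abelianGroup using (x∙y⁻¹≈ε⇒x≈y)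
  0<∣p-q∣ : 0ℚ ℚ.< ∣ p ℚ.- q ∣
  0<∣p-q∣ = ℚ.≰⇒> λ ∣p-q∣≤0 →
    p≢q (x∙y⁻¹≈ε⇒x≈y p q (ℚ.∣p∣≡0⇒p≡0 _ (ℚ.≤-antisym ∣p-q∣≤0 (ℚ.0≤∣p∣ _))))

fromℕ-injective : ∀ {m n} → fromℕ m ≈ fromℕ n → m ≡ n
fromℕ-injective m≈n = /1-injective (fromℚ-injective m≈n)

fromℕ-+ : ∀ m n → fromℕ (m ℕ.+ n) ≈ fromℕ m + fromℕ n
fromℕ-+ m n = pointwise {fromℕ (m ℕ.+ n)} {fromℕ m + fromℕ n} λ _ → /1-+ m n

fromℕ-* : ∀ m n → fromℕ (m ℕ.* n) ≈ fromℕ m * fromℕ n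
fromℕ-* m n = pointwise {fromℕ (m ℕ.* n)} {fromℕ m * fromℕ n} λ _ → /1-* m n

fromℚ-positive : ∀ {q} → 0ℚ ℚ.< q → ℝ₊ (fromℚ q)
fromℚ-positive {q} 0<q = let ε , 0<ε , ε<q = ℚ.<-dense 0<q in ε , 0<ε , 0 , λ _ _ → ε<q

fromℕ-positive : ∀ {n} → 0 ℕ.< n → ℝ₊ (fromℕ n)
fromℕ-positive {suc n} _ = fromℚ-positive (ℚ.positive⁻¹ (ℤ.+ suc n ℚ./ 1) {{ℚ.normalize-pos (suc n) 1}})

ℕ₊⊆ℝ₊ : ℕ₊ ⊆ ℝ₊
ℕ₊⊆ℝ₊ {x} (k , 0<k , x≈k) =
  ℝ₊-resp-≈ {fromℕ k} {x} (R.sym {x} {fromℕ k} x≈k) (fromℕ-positive 0<k)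

-- Powers of one half become arbitrarily small

½^_ : ℕ → ℚ
½^ zero  = 1ℚ
½^ suc n = ½ ℚ.* ½^ n

½^-positive : ∀ n → ℚ.Positive (½^ n)
½^-positive zero    = _
½^-positive (suc n) = ℚ.pos*pos⇒pos ½ (½^ n) {{½^-positive n}}

-- Bernoulli's inequality 1 + n ≤ 2^n, by induction from 2 + n ≤ 2(1 + n).
½^n*[1+n]≤1 : ∀ n → ½^ n ℚ.* (ℤ.+ suc n ℚ./ 1) ℚ.≤ 1ℚ
½^n*[1+n]≤1 zero    = ℚ.≤-refl
½^n*[1+n]≤1 (suc n) = begin
  ½ ℚ.* ½^ n ℚ.* (ℤ.+ suc (suc n) ℚ./ 1)
    ≤⟨ ℚ.*-monoˡ-≤-nonNeg (½ ℚ.* ½^ n) {{ℚ.pos⇒nonNeg (½ ℚ.* ½^ n) {{½^-positive (suc n)}}}} 2+n≤2[1+n] ⟩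
  ½ ℚ.* ½^ n ℚ.* (N ℚ.+ N)
    ≡⟨ cancel-½ (½^ n) N ⟩
  ½^ n ℚ.* N
    ≤⟨ ½^n*[1+n]≤1 n ⟩
  1ℚ ∎
  where
  open ℚ.≤-Reasoning
  N : ℚ
  N = ℤ.+ suc n ℚ./ 1
  cancel-½ : ∀ p q → ½ ℚ.* p ℚ.* (q ℚ.+ q) ≡ p ℚ.* q
  cancel-½ = solve 2 (λ p q → con ½ :* p :* (q :+ q) := p :* q) refl
  2+n≤2[1+n] : ℤ.+ suc (suc n) ℚ./ 1 ℚ.≤ N ℚ.+ N
  2+n≤2[1+n] = begin
    ℤ.+ suc (suc n) ℚ./ 1               ≡⟨ /1-+ 1 (suc n) ⟩
    1ℚ ℚ.+ N                            ≤⟨ ℚ.+-monoˡ-≤ N (begin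
      1ℚ                                  ≡⟨ ℚ.+-identityʳ 1ℚ ⟨
      1ℚ ℚ.+ 0ℚ                           ≤⟨ ℚ.+-monoʳ-≤ 1ℚ (ℚ.nonNegative⁻¹ (ℤ.+ n ℚ./ 1) {{ℚ.normalize-nonNeg n 1}}) ⟩
      1ℚ ℚ.+ (ℤ.+ n ℚ./ 1)                ≡⟨ /1-+ 1 n ⟨
      N                                   ∎) ⟩
    N ℚ.+ N                             ∎

-- Multiplying by the denominator leaves the numerator, a positive integer.
1≤p*↧p : ∀ p → 0ℚ ℚ.< p → 1ℚ ℚ.≤ p ℚ.* (ℤ.+ (ℚ.↧ₙ p) ℚ./ 1)
1≤p*↧p p@(ℚ.mkℚ (ℤ.+ zero) d _) 0<p = contradiction (ℚ.positive 0<p) λ ()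
1≤p*↧p p@(ℚ.mkℚ ℤ.-[1+ n ] d _) 0<p = contradiction (ℚ.positive 0<p) λ ()
1≤p*↧p p@(ℚ.mkℚ ℤ.+[1+ n ] d _) _   = subst (λ q → 1ℚ ℚ.≤ p ℚ.* q) (≡.sym (n/1≡mkℚ (suc d)))
  (ℚ.toℚᵘ-cancel-≤ {1ℚ} {p ℚ.* q} (ℚᵘ.≤-respʳ-≃ (ℚᵘ.≃-sym (ℚ.toℚᵘ-homo-* p q)) (ℚᵘ.*≤* (ℤ.+≤+ (s≤s (begin
    d ℕ.* 1 ℕ.+ 0                       ≡⟨ ℕ.+-identityʳ (d ℕ.* 1) ⟩
    d ℕ.* 1                             ≤⟨ ℕ.*-monoˡ-≤ 1 (ℕ.m≤m+n d (n ℕ.* suc d)) ⟩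
    (d ℕ.+ n ℕ.* suc d) ℕ.* 1           ∎))))))
  where
  open ℕ.≤-Reasoning
  q : ℚ
  q = ℚ.mkℚ (ℤ.+ suc d) 0 (Coprimality.sym (Coprimality.1-coprimeTo (suc d)))

-- The denominator N of ε is large enough: 2^-N ≤ 1/(N + 1) < 1/N ≤ ε.
½^-archimedean : ∀ ε → 0ℚ ℚ.< ε → ∃[ n ] ½^ n ℚ.< ε
½^-archimedean ε 0<ε = N , ℚ.*-cancelʳ-<-nonNeg 1+N {{ℚ.normalize-nonNeg (suc N) 1}} (begin-strict
  ½^ N ℚ.* 1+N                ≤⟨ ½^n*[1+n]≤1 N ⟩
  1ℚ                          ≤⟨ 1≤p*↧p ε 0<ε ⟩
  ε ℚ.* (ℤ.+ N ℚ./ 1)         <⟨ ℚ.*-monoʳ-<-pos ε {{ℚ.positive 0<ε}} N<1+N ⟩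
  ε ℚ.* 1+N                   ∎)
  where
  open ℚ.≤-Reasoning
  N : ℕ
  N = ℚ.↧ₙ ε
  1+N : ℚ
  1+N = ℤ.+ suc N ℚ./ 1
  N<1+N : ℤ.+ N ℚ./ 1 ℚ.< 1+N
  N<1+N = subst₂ ℚ._<_ (ℚ.+-identityˡ _) (≡.sym (/1-+ 1 N))
    (ℚ.+-monoˡ-< (ℤ.+ N ℚ./ 1) (ℚ.positive⁻¹ 1ℚ))

-- p ↦ p − (p² − p − 1) / 2 is a contraction of [1, 2] whose fixed point is the
-- golden ratio.
goldenStep : ℚ → ℚ
goldenStep p = p ℚ.- ½ ℚ.* (p ℚ.* p ℚ.- (p ℚ.+ 1ℚ))

2ℚ : ℚ
2ℚ = 1ℚ ℚ.+ 1ℚ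

In[1,2] : ℚ → Set
In[1,2] p = 1ℚ ℚ.≤ p × p ℚ.≤ 2ℚ

-b≤p≤b⇒∣p∣≤b : ∀ {p b} → ℚ.- b ℚ.≤ p → p ℚ.≤ b → ∣ p ∣ ℚ.≤ b
-b≤p≤b⇒∣p∣≤b {p} {b} -b≤p p≤b with ℚ.∣p∣≡p∨∣p∣≡-p p
... | inj₁ eq = subst (ℚ._≤ b) (≡.sym eq) p≤b
... | inj₂ eq = subst₂ ℚ._≤_ (≡.sym eq) (neg-involutive b) (ℚ.neg-antimono-≤ -b≤p)
  where open AbelianGroupProperties ℚ.+-0-abelianGroup renaming (⁻¹-involutive to neg-involutive)

0≤q-p : ∀ {p q} → p ℚ.≤ q → 0ℚ ℚ.≤ q ℚ.- p
0≤q-p {p} {q} p≤q = subst (ℚ._≤ q ℚ.- p) (ℚ.+-inverseʳ p) (ℚ.+-monoˡ-≤ (ℚ.- p) p≤q)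

p≤p+q : ∀ p {q} → 0ℚ ℚ.≤ q → p ℚ.≤ p ℚ.+ q
p≤p+q p {q} 0≤q = subst (ℚ._≤ p ℚ.+ q) (ℚ.+-identityʳ p) (ℚ.+-monoʳ-≤ p 0≤q)

0≤p*q : ∀ {p q} → 0ℚ ℚ.≤ p → 0ℚ ℚ.≤ q → 0ℚ ℚ.≤ p ℚ.* q
0≤p*q {p} {q} 0≤p 0≤q = ℚ.nonNegative⁻¹ (p ℚ.* q)
  {{ℚ.nonNeg*nonNeg⇒nonNeg p {{ℚ.nonNegative 0≤p}} q {{ℚ.nonNegative 0≤q}}}}

0≤½ : 0ℚ ℚ.≤ ½
0≤½ = ℚ.nonNegative⁻¹ ½

-- With u = p - 1 and v = 2 - p, the distances of the new point from 1 and 2 are (uv + 1)/2 and (v +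
-- u²)/2.
goldenStep-interval : ∀ p → In[1,2] p → In[1,2] (goldenStep p)
goldenStep-interval p (1≤p , p≤2) =
    subst (1ℚ ℚ.≤_) (lower p) (p≤p+q 1ℚ (0≤p*q 0≤½ (ℚ.≤-trans 0≤uv (p≤p+q uv (ℚ.nonNegative⁻¹ 1ℚ)))))
  , subst (goldenStep p ℚ.≤_) (upper p) (p≤p+q (goldenStep p) (0≤p*q 0≤½ (ℚ.≤-trans 0≤v
      (p≤p+q v (0≤p*q 0≤u 0≤u)))))
  where
  u v uv : ℚ
  u = p ℚ.- 1ℚ
  v = 2ℚ ℚ.- p
  uv = u ℚ.* v
  0≤u : 0ℚ ℚ.≤ u
  0≤u = 0≤q-p 1≤p
  0≤v : 0ℚ ℚ.≤ v
  0≤v = 0≤q-p p≤2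
  0≤uv : 0ℚ ℚ.≤ uv
  0≤uv = 0≤p*q 0≤u 0≤v
  lower : ∀ p → 1ℚ ℚ.+ ½ ℚ.* ((p ℚ.- 1ℚ) ℚ.* (2ℚ ℚ.- p) ℚ.+ 1ℚ) ≡ goldenStep p
  lower = solve 1 (λ p → con 1ℚ :+ con ½ :* ((p :- con 1ℚ) :* (con 2ℚ :- p) :+ con 1ℚ)
    := p :- con ½ :* (p :* p :- (p :+ con 1ℚ))) refl
  upper : ∀ p → goldenStep p ℚ.+ ½ ℚ.* ((2ℚ ℚ.- p) ℚ.+ (p ℚ.- 1ℚ) ℚ.* (p ℚ.- 1ℚ)) ≡ 2ℚ
  upper = solve 1 (λ p → p :- con ½ :* (p :* p :- (p :+ con 1ℚ))
    :+ con ½ :* ((con 2ℚ :- p) :+ (p :- con 1ℚ) :* (p :- con 1ℚ)) := con 2ℚ) refl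

-- The difference of the images is (p - q)(3 - p - q)/2, and 3 - p - q lies in [-1, 1] when p and q
-- lie in [1, 2].
goldenStep-contraction : ∀ p q → In[1,2] p → In[1,2] q →
  ∣ goldenStep p ℚ.- goldenStep q ∣ ℚ.≤ ½ ℚ.* ∣ p ℚ.- q ∣
goldenStep-contraction p q (1≤p , p≤2) (1≤q , q≤2) = begin
  ∣ goldenStep p ℚ.- goldenStep q ∣        ≡⟨ cong ∣_∣ (factor p q) ⟩
  ∣ ½ ℚ.* (p ℚ.- q) ℚ.* s ∣                ≡⟨ ℚ.∣p*q∣≡∣p∣*∣q∣ (½ ℚ.* (p ℚ.- q)) s ⟩
  ∣ ½ ℚ.* (p ℚ.- q) ∣ ℚ.* ∣ s ∣            ≤⟨ ℚ.*-monoˡ-≤-nonNeg ∣ ½ ℚ.* (p ℚ.- q) ∣ {{ℚ.∣-∣-nonNeg (½ ℚ.* (p ℚ.- q))}} ∣s∣≤1 ⟩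
  ∣ ½ ℚ.* (p ℚ.- q) ∣ ℚ.* 1ℚ               ≡⟨ ℚ.*-identityʳ _ ⟩
  ∣ ½ ℚ.* (p ℚ.- q) ∣                      ≡⟨ ℚ.∣p*q∣≡∣p∣*∣q∣ ½ (p ℚ.- q) ⟩
  ½ ℚ.* ∣ p ℚ.- q ∣                        ∎
  where
  open ℚ.≤-Reasoning
  s : ℚ
  s = 2ℚ ℚ.+ 1ℚ ℚ.- (p ℚ.+ q)
  factor : ∀ p q → goldenStep p ℚ.- goldenStep q ≡ ½ ℚ.* (p ℚ.- q) ℚ.* (2ℚ ℚ.+ 1ℚ ℚ.- (p ℚ.+ q))
  factor = solve 2 (λ p q →
    (p :- con ½ :* (p :* p :- (p :+ con 1ℚ))) :- (q :- con ½ :* (q :* q :- (q :+ con 1ℚ)))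
      := con ½ :* (p :- q) :* (con 2ℚ :+ con 1ℚ :- (p :+ q))) refl
  ∣s∣≤1 : ∣ s ∣ ℚ.≤ 1ℚ
  ∣s∣≤1 = -b≤p≤b⇒∣p∣≤b
    (ℚ.+-monoʳ-≤ (2ℚ ℚ.+ 1ℚ) (ℚ.neg-antimono-≤ (ℚ.+-mono-≤ p≤2 q≤2)))
    (ℚ.+-monoʳ-≤ (2ℚ ℚ.+ 1ℚ) (ℚ.neg-antimono-≤ (ℚ.+-mono-≤ 1≤p 1≤q)))

goldenSeq : ℕ → ℚ
goldenSeq zero    = 1ℚ
goldenSeq (suc n) = goldenStep (goldenSeq n)

goldenSeq-interval : ∀ n → In[1,2] (goldenSeq n)
goldenSeq-interval zero    = ℚ.≤-refl , p≤p+q 1ℚ (ℚ.nonNegative⁻¹ 1ℚ)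
goldenSeq-interval (suc n) = goldenStep-interval (goldenSeq n) (goldenSeq-interval n)

-- All terms lie in an interval of length 1, and each step halves distances.
goldenSeq-close : ∀ n k l → ∣ goldenSeq (n ℕ.+ k) ℚ.- goldenSeq (n ℕ.+ l) ∣ ℚ.≤ ½^ n
goldenSeq-close zero k l = -b≤p≤b⇒∣p∣≤b
  (ℚ.+-mono-≤ (proj₁ (goldenSeq-interval k)) (ℚ.neg-antimono-≤ (proj₂ (goldenSeq-interval l))))
  (ℚ.+-mono-≤ (proj₂ (goldenSeq-interval k)) (ℚ.neg-antimono-≤ (proj₁ (goldenSeq-interval l))))
goldenSeq-close (suc n) k l = ℚ.≤-trans
  (goldenStep-contraction (goldenSeq (n ℕ.+ k)) (goldenSeq (n ℕ.+ l))
    (goldenSeq-interval (n ℕ.+ k)) (goldenSeq-interval (n ℕ.+ l)))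
  (ℚ.*-monoˡ-≤-nonNeg ½ (goldenSeq-close n k l))

goldenSeq-eventually-close : ∀ {ε} N → ½^ N ℚ.< ε → ∀ m n → N ≤ m → N ≤ n →
  ∣ goldenSeq m ℚ.- goldenSeq n ∣ ℚ.< ε
goldenSeq-eventually-close {ε} N ½^N<ε m n N≤m N≤n =
  subst₂ (λ k l → ∣ goldenSeq k ℚ.- goldenSeq l ∣ ℚ.< ε)
    (ℕ.m+[n∸m]≡n N≤m) (ℕ.m+[n∸m]≡n N≤n)
    (ℚ.≤-<-trans (goldenSeq-close N (m ℕ.∸ N) (n ℕ.∸ N)) ½^N<ε)

goldenSeq-isCauchy : IsCauchy goldenSeq
goldenSeq-isCauchy ε 0<ε = let N , ½^N<ε = ½^-archimedean ε 0<ε in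
  N , goldenSeq-eventually-close N ½^N<ε

φ : ℝ
φ = mkℝ goldenSeq goldenSeq-isCauchy

φ-positive : ℝ₊ φ
φ-positive = ½ , ℚ.positive⁻¹ ½ , 0 , λ n _ → ℚ.<-≤-trans ½<1 (proj₁ (goldenSeq-interval n))
  where
  ½<1 : ½ ℚ.< 1ℚ
  ½<1 = ℚ.*<* (ℤ.+<+ (s≤s (s≤s z≤n)))

-- The residual p² - p - 1 is twice the difference of consecutive terms, which tends to 0.
φ*φ≈φ+1 : φ * φ ≈ φ + 1ℝ
φ*φ≈φ+1 = IsNull-cong (λ n → residual (goldenSeq n))
  (IsNull-+ {d} {d} d→0 d→0)
  where
  d : ℕ → ℚ
  d n = goldenSeq n ℚ.- goldenSeq (suc n)
  d→0 : IsNull d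
  d→0 ε 0<ε = let N , close = goldenSeq-isCauchy ε 0<ε in
    N , λ n N≤n → close n (suc n) N≤n (ℕ.m≤n⇒m≤1+n N≤n)
  residual : ∀ p → (p ℚ.- goldenStep p) ℚ.+ (p ℚ.- goldenStep p) ≡ p ℚ.* p ℚ.- (p ℚ.+ 1ℚ)
  residual = solve 1 (λ p →
    (p :- (p :- con ½ :* (p :* p :- (p :+ con 1ℚ)))) :+ (p :- (p :- con ½ :* (p :* p :- (p :+ con 1ℚ))))
      := p :* p :- (p :+ con 1ℚ)) refl

-- Realising pairs of sizes by explicit sets

open Equivalence using (to; from)

module Realisation {K : Set} (_≟_ : DecidableEquality K) (_⊕_ _⊗_ : K → K → K) (⟦_⟧ : K → ℝ)
  (⟦⟧-injective : ∀ {k l} → ⟦ k ⟧ ≈ ⟦ l ⟧ → k ≡ l)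
  (⟦⟧-⊕ : ∀ k l → ⟦ k ⊕ l ⟧ ≈ ⟦ k ⟧ + ⟦ l ⟧)
  (⟦⟧-⊗ : ∀ k l → ⟦ k ⊗ l ⟧ ≈ ⟦ k ⟧ * ⟦ l ⟧) where

  open SetoidMembership (≡.setoid K) using () renaming (_∈_ to _∈ₗ_)

  -- Closed under `_≈_`, as `HasSize` demands.
  Image : List K → Pred ℝ 0ℓ
  Image ks x = ∃[ k ] (k ∈ₗ ks × x ≈ ⟦ k ⟧)

  -- Counted in `K`, where equality is decidable, so it evaluates to a numeral on a closed list;
  -- injectivity of `⟦_⟧` makes it the size in the reals.
  size : List K → ℕ
  size ks = length (deduplicate _≟_ ks)

  image-size : ∀ {B} ks → (∀ x → x ∈ B ⇔ x ∈ Image ks) → HasSize B (size ks)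
  image-size ks B⇔ =
      (λ i → ⟦ lookup uniques i ⟧)
    , (λ {i} {j} e → K.lookup-injective (Unique.deduplicate-! _≟_ ks) i j (⟦⟧-injective e))
    , λ x → mk⇔
        (λ x∈B → let k , k∈ks , x≈k = to (B⇔ x) x∈B
                     k∈ = ∈.∈-deduplicate⁺ _≟_ k∈ks
          in Any.index k∈ , subst (λ l → x ≈ ⟦ l ⟧) (Any.lookup-index k∈) x≈k)
        (λ (i , x≈) → from (B⇔ x) (lookup uniques i
          , ∈.∈-deduplicate⁻ _≟_ ks (∈.∈-lookup i) , x≈))
    where
    module K = Cardinality (≡.setoid K)
    uniques : List K
    uniques = deduplicate _≟_ ks

  pairwise-image : ∀ (_∙_ : ℝ → ℝ → ℝ) (_⊙_ : K → K → K) →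
    (∀ {x y u v} → x ≈ y → u ≈ v → (x ∙ u) ≈ (y ∙ v)) →
    (∀ k l → ⟦ k ⊙ l ⟧ ≈ (⟦ k ⟧ ∙ ⟦ l ⟧)) → ∀ ks z →
    (∃[ x ] ∃[ y ] (x ∈ Image ks × y ∈ Image ks × z ≈ (x ∙ y)))
      ⇔ z ∈ Image (cartesianProductWith _⊙_ ks ks)
  pairwise-image _∙_ _⊙_ ∙-cong ⟦⟧-⊙ ks z = mk⇔
    (λ (x , y , (k , k∈ , x≈) , (l , l∈ , y≈) , z≈) →
      k ⊙ l , ∈.∈-cartesianProductWith⁺ _⊙_ k∈ l∈ ,
      R.trans {z} {x ∙ y} {⟦ k ⊙ l ⟧} z≈
        (R.trans {x ∙ y} {⟦ k ⟧ ∙ ⟦ l ⟧} {⟦ k ⊙ l ⟧} (∙-cong {x} {⟦ k ⟧} {y} {⟦ l ⟧} x≈ y≈)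
          (R.sym {⟦ k ⊙ l ⟧} {⟦ k ⟧ ∙ ⟦ l ⟧} (⟦⟧-⊙ k l))))
    λ (m , m∈ , z≈) → let k , l , k∈ , l∈ , m≡ = ∈.∈-cartesianProductWith⁻ _⊙_ ks ks m∈ in
      ⟦ k ⟧ , ⟦ l ⟧ , (k , k∈ , R.refl {⟦ k ⟧}) , (l , l∈ , R.refl {⟦ l ⟧}) ,
      R.trans {z} {⟦ m ⟧} {⟦ k ⟧ ∙ ⟦ l ⟧} z≈
        (subst (λ m → ⟦ m ⟧ ≈ (⟦ k ⟧ ∙ ⟦ l ⟧)) (≡.sym m≡) (⟦⟧-⊙ k l))

  realise : ∀ {X} ks → All (λ k → ∀ {x} → x ≈ ⟦ k ⟧ → x ∈ X) ks →
    SPP[ X ] (size ks)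
      (size (cartesianProductWith _⊕_ ks ks) , size (cartesianProductWith _⊗_ ks ks))
  realise ks ks⊆X =
      Image ks
    , (λ {x} (k , k∈ , x≈) → All.lookup ks⊆X k∈ {x} x≈)
    , image-size ks (λ _ → mk⇔ id id)
    , image-size (cartesianProductWith _⊕_ ks ks)
        (pairwise-image _+_ _⊕_ (λ {x} {y} {u} {v} → +-cong {x} {y} {u} {v}) ⟦⟧-⊕ ks)
    , image-size (cartesianProductWith _⊗_ ks ks)
        (pairwise-image _*_ _⊗_ (λ {x} {y} {u} {v} → *-cong {x} {y} {u} {v}) ⟦⟧-⊗ ks)

private
  module SP = SumProduct ℝ-orderedRing
  module ι = SP.NaturalNumbers fromℕ fromℕ-injective fromℕ-+ fromℕ-*
  module ℤ[φ] = ι.GoldenIntegers fromℕ-positive {φ} φ-positive φ*φ≈φ+1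

  module FromNaturals = Realisation ℕ._≟_ ℕ._+_ ℕ._*_ fromℕ fromℕ-injective fromℕ-+ fromℕ-*
  module FromGolden = Realisation (Product.≡-dec ℕ._≟_ ℕ._≟_) ℤ[φ]._⊕_ ℤ[φ]._⊗_ ℤ[φ].⟦_⟧
    ℤ[φ].⟦⟧-injective ℤ[φ].⟦⟧-⊕ ℤ[φ].⟦⟧-⊗

-- On a closed list the sizes and the positivity check both reduce by evaluation, so applying this
-- to the list is a complete proof.
realise-ℕ : ∀ ks {_ : True (All.all? (1 ℕ.≤?_) ks)} → let open FromNaturals using (size) in
  SPP (size ks) (size (cartesianProductWith ℕ._+_ ks ks) , size (cartesianProductWith ℕ._*_ ks ks))
realise-ℕ ks {0<ks} =
  FromNaturals.realise {ℕ₊} ks (All.map (λ {k} 0<k {_} x≈k → k , 0<k , x≈k) (toWitness 0<ks))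

realise-ℤ[φ] : ∀ ks {_ : True (All.all? (λ (m , n) → 1 ℕ.≤? m ℕ.+ n) ks)} →
  let open FromGolden using (size) in
  SPP[ ℝ₊ ] (size ks)
    (size (cartesianProductWith ℤ[φ]._⊕_ ks ks) , size (cartesianProductWith ℤ[φ]._⊗_ ks ks))
realise-ℤ[φ] ks {0<ks} = FromGolden.realise {ℝ₊} ks (All.map
  (λ { {m , n} 0<k {x} x≈k → ℝ₊-resp-≈ {ℤ[φ].⟦ m , n ⟧} {x}
    (R.sym {x} {ℤ[φ].⟦ m , n ⟧} x≈k) (ℤ[φ].⟦⟧-positive m n 0<k) })
  (toWitness 0<ks))

-- The value sets for n at most four

SPP⊆SPP[ℝ₊] : ∀ {n} → SPP n ⊆ SPP[ ℝ₊ ] n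
SPP⊆SPP[ℝ₊] (A , A⊆ℕ₊ , sizes) = A , (λ {x} x∈A → ℕ₊⊆ℝ₊ {x} (A⊆ℕ₊ {x} x∈A)) , sizes

-- Natural numbers are positive reals, so the inclusions close into a cycle and all three predicates
-- agree.
sandwich : ∀ {n} {E : Pred (ℕ × ℕ) 0ℓ} → SPP[ ℝ₊ ] n ⊆ E → E ⊆ SPP n →
  SPP[ ℝ₊ ] n ≐ SPP n × SPP n ≐ E
sandwich SPP[ℝ₊]⊆E E⊆SPP =
  (E⊆SPP ∘ SPP[ℝ₊]⊆E , SPP⊆SPP[ℝ₊]) , (SPP[ℝ₊]⊆E ∘ SPP⊆SPP[ℝ₊] , E⊆SPP)

≤-suc-cases : ∀ {m n} → m ≤ n → n ≤ suc m → m ≡ n ⊎ suc m ≡ n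
≤-suc-cases m≤n n≤1+m with ℕ.m≤n⇒m<n∨m≡n m≤n
... | inj₁ m<n = inj₂ (ℕ.≤-antisym m<n n≤1+m)
... | inj₂ m≡n = inj₁ m≡n

SPP₃ : Pred (ℕ × ℕ) 0ℓ
SPP₃ = ｛ (5 , 6) ｝ ∪ ｛ (6 , 5) ｝ ∪ ｛ (6 , 6) ｝

SPP₄ : Pred (ℕ × ℕ) 0ℓ
SPP₄ = (λ (i , j) → (7 ≤ i × i ≤ 10) × (9 ≤ j × j ≤ 10)) ∪ ｛ (10 , 7) ｝ ∪ ｛ (10 , 8) ｝

SPP[ℝ₊]1⊆ : SPP[ ℝ₊ ] 1 ⊆ ｛ (1 , 1) ｝
SPP[ℝ₊]1⊆ (A , A⊆ℝ₊ , size , sumSize , productSize) =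
  let 1≡s , 1≡p = SP.size₁-sum-product (λ {x} → A⊆ℝ₊ {x}) sumSize productSize size
  in cong₂ _,_ 1≡s 1≡p

SPP[ℝ₊]2⊆ : SPP[ ℝ₊ ] 2 ⊆ ｛ (3 , 3) ｝
SPP[ℝ₊]2⊆ (A , A⊆ℝ₊ , size , sumSize , productSize) =
  let 3≡s , 3≡p = SP.size₂-sum-product (λ {x} → A⊆ℝ₊ {x}) sumSize productSize size
  in cong₂ _,_ 3≡s 3≡p

bounds⇒SPP₃ : ∀ {s p} → (5 ≤ s × s ≤ 6) × (5 ≤ p × p ≤ 6) × ¬ (s ≤ 5 × p ≤ 5) → SPP₃ (s , p)
bounds⇒SPP₃ ((5≤s , s≤6) , (5≤p , p≤6) , ¬5,5) with ≤-suc-cases 5≤s s≤6 | ≤-suc-cases 5≤p p≤6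
... | inj₁ refl | inj₁ refl = contradiction (ℕ.≤-refl , ℕ.≤-refl) ¬5,5
... | inj₁ refl | inj₂ refl = inj₁ refl
... | inj₂ refl | inj₁ refl = inj₂ (inj₁ refl)
... | inj₂ refl | inj₂ refl = inj₂ (inj₂ refl)

SPP[ℝ₊]3⊆SPP₃ : SPP[ ℝ₊ ] 3 ⊆ SPP₃
SPP[ℝ₊]3⊆SPP₃ (A , A⊆ℝ₊ , size , sumSize , productSize) =
  bounds⇒SPP₃ (SP.size₃-sum-product (λ {x} → A⊆ℝ₊ {x}) sumSize productSize size)

SPP₃⊆SPP : SPP₃ ⊆ SPP 3
-- An arithmetic progression, a geometric progression, and a triple that is neither.
SPP₃⊆SPP (inj₁ refl)        = realise-ℕ (1 ∷ 2 ∷ 3 ∷ [])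
SPP₃⊆SPP (inj₂ (inj₁ refl)) = realise-ℕ (1 ∷ 2 ∷ 4 ∷ [])
SPP₃⊆SPP (inj₂ (inj₂ refl)) = realise-ℕ (1 ∷ 3 ∷ 4 ∷ [])

SPP₄⊆SPP : SPP₄ ⊆ SPP 4
-- Powers of 2 with exponents 0, 1, 2, 3 and 0, 1, 2, 4; all ten sums are distinct in both.
SPP₄⊆SPP (inj₂ (inj₁ refl)) = realise-ℕ (1 ∷ 2 ∷ 4 ∷ 8 ∷ [])
SPP₄⊆SPP (inj₂ (inj₂ refl)) = realise-ℕ (1 ∷ 2 ∷ 4 ∷ 16 ∷ [])
-- The sets with nine products have the single product coincidence 1·4 = 2·2, 2·6 = 3·4 or 2·8 =
-- 4·4; those with ten have none.
SPP₄⊆SPP {s , p} (inj₁ ((7≤s , s≤10) , (9≤p , p≤10))) with s ℕ.≤? 8 | ≤-suc-cases 9≤p p≤10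
... | yes s≤8 | inj₁ refl with ≤-suc-cases 7≤s s≤8
...   | inj₁ refl = realise-ℕ (1 ∷ 2 ∷ 3 ∷ 4 ∷ [])
...   | inj₂ refl = realise-ℕ (2 ∷ 3 ∷ 4 ∷ 6 ∷ [])
SPP₄⊆SPP {s , p} (inj₁ ((7≤s , s≤10) , (9≤p , p≤10))) | yes s≤8 | inj₂ refl with ≤-suc-cases 7≤s s≤8
...   | inj₁ refl = realise-ℕ (2 ∷ 3 ∷ 4 ∷ 5 ∷ [])
...   | inj₂ refl = realise-ℕ (1 ∷ 2 ∷ 3 ∷ 5 ∷ [])
SPP₄⊆SPP {s , p} (inj₁ ((7≤s , s≤10) , (9≤p , p≤10))) | no s≰8 | inj₁ refl
  with ≤-suc-cases (ℕ.≰⇒> s≰8) s≤10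
...   | inj₁ refl = realise-ℕ (1 ∷ 2 ∷ 4 ∷ 5 ∷ [])
...   | inj₂ refl = realise-ℕ (2 ∷ 4 ∷ 7 ∷ 8 ∷ [])
SPP₄⊆SPP {s , p} (inj₁ ((7≤s , s≤10) , (9≤p , p≤10))) | no s≰8 | inj₂ refl
  with ≤-suc-cases (ℕ.≰⇒> s≰8) s≤10
...   | inj₁ refl = realise-ℕ (1 ∷ 2 ∷ 5 ∷ 6 ∷ [])
...   | inj₂ refl = realise-ℕ (1 ∷ 2 ∷ 5 ∷ 7 ∷ [])

bounds⇒SPP₄ : ∀ {s p} → (7 ≤ s × s ≤ 10) × (7 ≤ p × p ≤ 10) × (p ≤ 8 → 9 ≤ s) →
  (p ≤ 8 → 10 ≤ s) → SPP₄ (s , p)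
bounds⇒SPP₄ {s} {p} ((7≤s , s≤10) , (7≤p , p≤10) , _) few with p ℕ.≤? 8
... | no p≰8 = inj₁ ((7≤s , s≤10) , (ℕ.≰⇒> p≰8 , p≤10))
... | yes p≤8 with ≤-suc-cases 7≤p p≤8 | ℕ.≤-antisym (few p≤8) s≤10
...   | inj₁ refl | refl = inj₂ (inj₁ refl)
...   | inj₂ refl | refl = inj₂ (inj₂ refl)

bounds⇒SPP₄∪ : ∀ {s p} → (7 ≤ s × s ≤ 10) × (7 ≤ p × p ≤ 10) × (p ≤ 8 → 9 ≤ s) →
  SPP₄ (s , p) ⊎ (｛ (9 , 7) ｝ ∪ ｛ (9 , 8) ｝) (s , p)
bounds⇒SPP₄∪ {s} {p} ((7≤s , s≤10) , (7≤p , p≤10) , few) with p ℕ.≤? 8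
... | no p≰8 = inj₁ (inj₁ ((7≤s , s≤10) , (ℕ.≰⇒> p≰8 , p≤10)))
... | yes p≤8 with ≤-suc-cases (few p≤8) s≤10 | ≤-suc-cases 7≤p p≤8
...   | inj₁ refl | inj₁ refl = inj₂ (inj₁ refl)
...   | inj₁ refl | inj₂ refl = inj₂ (inj₂ refl)
...   | inj₂ refl | inj₁ refl = inj₁ (inj₂ (inj₁ refl))
...   | inj₂ refl | inj₂ refl = inj₁ (inj₂ (inj₂ refl))

SPP4⊆SPP₄ : SPP 4 ⊆ SPP₄
SPP4⊆SPP₄ (A , A⊆ℕ₊ , size , sumSize , productSize) = bounds⇒SPP₄
  (SP.size₄-sum-product A⊆ℝ₊ sumSize productSize size)
  (SP.size₄-few-products A⊆ℝ₊ sumSize productSize size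
    λ {a} {b} {c} {d} a∈A b∈A c∈A d∈A →
      let k , 0<k , a≈k = A⊆ℕ₊ {a} a∈A
          l , 0<l , b≈l = A⊆ℕ₊ {b} b∈A
          m , _   , c≈m = A⊆ℕ₊ {c} c∈A
          n , _   , d≈n = A⊆ℕ₊ {d} d∈A
      in ι.unexceptional {a} {b} {c} {d} k l m n {{ℕ.>-nonZero 0<k}} {{ℕ.>-nonZero 0<l}}
           a≈k b≈l c≈m d≈n)
  where
  A⊆ℝ₊ : A ⊆ ℝ₊
  A⊆ℝ₊ {x} x∈A = ℕ₊⊆ℝ₊ {x} (A⊆ℕ₊ {x} x∈A)

SPP[ℝ₊]4⊆ : SPP[ ℝ₊ ] 4 ⊆ SPP 4 ∪ ｛ (9 , 7) ｝ ∪ ｛ (9 , 8) ｝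
SPP[ℝ₊]4⊆ (A , A⊆ℝ₊ , size , sumSize , productSize) = map₁ SPP₄⊆SPP
  (bounds⇒SPP₄∪ (SP.size₄-sum-product (λ {x} → A⊆ℝ₊ {x}) sumSize productSize size))

⊆SPP[ℝ₊]4 : SPP 4 ∪ ｛ (9 , 7) ｝ ∪ ｛ (9 , 8) ｝ ⊆ SPP[ ℝ₊ ] 4
⊆SPP[ℝ₊]4 (inj₁ spp)         = SPP⊆SPP[ℝ₊] spp
-- 1, φ, φ², φ³ and 1, φ², φ³, φ⁴
⊆SPP[ℝ₊]4 (inj₂ (inj₁ refl)) = realise-ℤ[φ] ((1 , 0) ∷ (0 , 1) ∷ (1 , 1) ∷ (1 , 2) ∷ [])
⊆SPP[ℝ₊]4 (inj₂ (inj₂ refl)) = realise-ℤ[φ] ((1 , 0) ∷ (1 , 1) ∷ (1 , 2) ∷ (2 , 3) ∷ [])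

theorem5 : (SPP[ ℝ₊ ] 1 ≐ SPP 1 × SPP 1 ≐ ｛ (1 , 1) ｝)
    × (SPP[ ℝ₊ ] 2 ≐ SPP 2 × SPP 2 ≐ ｛ (3 , 3) ｝)
    × (SPP[ ℝ₊ ] 3 ≐ SPP 3 × SPP 3 ≐ ｛ (5 , 6) ｝ ∪ ｛ (6 , 5) ｝ ∪ ｛ (6 , 6) ｝)
    × SPP 4 ≐ (λ (i , j) → (7 ≤ i × i ≤ 10) × (9 ≤ j × j ≤ 10)) ∪ ｛ (10 , 7) ｝ ∪ ｛ (10 , 8) ｝
    × SPP[ ℝ₊ ] 4 ≐ SPP 4 ∪ ｛ (9 , 7) ｝ ∪ ｛ (9 , 8) ｝
theorem5 =
    sandwich SPP[ℝ₊]1⊆ (λ { refl → realise-ℕ (1 ∷ []) })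
  , sandwich SPP[ℝ₊]2⊆ (λ { refl → realise-ℕ (1 ∷ 2 ∷ []) })
  , sandwich SPP[ℝ₊]3⊆SPP₃ SPP₃⊆SPP
  , (SPP4⊆SPP₄ , SPP₄⊆SPP)
  , (SPP[ℝ₊]4⊆ , ⊆SPP[ℝ₊]4)
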